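{- Let $\mathbb{F}$ be a field of characteristic $p(\mathbb{F})$, let $A$ be a finite subset of $\mathbb{F}$, and let $a_1,\dots,a_n\in\mathbb{F}\setminus\{0\}$. Let $n_1,\dots,n_t$ be the multiplicities of the distinct values occurring among $a_1,\dots,a_n$ (so $\sum_{i=1}^t n_i=n$), and put $$d:=n\big(|A|-n\big)+\sum_{1\le i<j\le t}n_in_j.$$ If $p(\mathbb{F})>d$, then $$\left|\left\{\sum_{i=1}^n a_ix_i \;:\; x_1,\dots,x_n\in A,\ x_i\neq x_j \text{ for } i\neq j\right\}\right|\ \ge\ d+1.$$
   Context: The $a_i$ are not assumed to be distinct; if the distinct values among them are $c_1,\dots,c_t$, then $n_j$ is the number of indices $i$ with $a_i=c_j$.
   Formalization: The hypothesis n ≤ |A| is added: otherwise the set of sums is empty and the bound can fail (F_5, |A| = 3, a = 1, 2, 3, 4 gives d = 2). The field is assumed to have decidable equality, which excluded middle supplies; characteristic 0 counts as infinite. -}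

module Defs where

open import Level using (Level; _⊔_) renaming (suc to lsuc)
open import Algebra.Bundles using (CommutativeRing)
open import Data.Nat as ℕ using (ℕ; zero; suc)
open import Data.Fin using (Fin; zero; suc)
open import Data.Bool using (Bool; true; false)
open import Data.Product using (Σ; ∃; _×_; _,_)
open import Data.Sum using (_⊎_)
open import Data.List using (List)
open import Relation.Nullary using (¬_; does)
open import Relation.Binary using (Decidable)
open import Relation.Binary.PropositionalEquality using (_≡_)

record Field (c ℓ : Level) : Set (lsuc (c ⊔ ℓ)) where
  field
    commutativeRing : CommutativeRing c ℓ
  open CommutativeRing commutativeRing public
  field
    _≟_     : Decidable _≈_
    1≉0     : ¬ (1# ≈ 0#)
    inverse : ∀ x → ¬ (x ≈ 0#) → ∃ λ y → (x * y) ≈ 1#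

count : ∀ {n} → (Fin n → Bool) → ℕ
count {zero}  P = 0
count {suc n} P with P zero
... | true  = suc (count (λ i → P (suc i)))
... | false = count (λ i → P (suc i))

sumℕ : ∀ {t} → (Fin t → ℕ) → ℕ
sumℕ {zero}  m = 0
sumℕ {suc t} m = m zero ℕ.+ sumℕ (λ i → m (suc i))

pairSum : ∀ {t} → (Fin t → ℕ) → ℕ
pairSum {zero}  m = 0
pairSum {suc t} m = m zero ℕ.* sumℕ (λ i → m (suc i)) ℕ.+ pairSum (λ i → m (suc i))

module FieldDefs {c ℓ : Level} (F : Field c ℓ) where
  open Field F public
  open import Algebra.Definitions.RawMonoid +-rawMonoid using (sum) renaming (_×_ to _×ₙ_)
  open import Data.List.Membership.Setoid setoid using (_∈_)

  IsCharacteristic : ℕ → Set ℓ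
  IsCharacteristic p =
    (p ≡ 0 × (∀ k → 1 ℕ.≤ k → ¬ ((k ×ₙ 1#) ≈ 0#)))
    ⊎ (1 ℕ.≤ p × (p ×ₙ 1#) ≈ 0# × (∀ k → 1 ℕ.≤ k → k ℕ.< p → ¬ ((k ×ₙ 1#) ≈ 0#)))

  mult : ∀ {n} → (Fin n → Carrier) → Carrier → ℕ
  mult a v = count (λ i → does (a i ≟ v))

  DistinctValues : ∀ {n t} → (Fin n → Carrier) → (Fin t → Carrier) → Set ℓ
  DistinctValues {n} {t} a cs =
    (∀ (j k : Fin t) → cs j ≈ cs k → j ≡ k)
    × (∀ (i : Fin n) → ∃ λ (j : Fin t) → a i ≈ cs j)
    × (∀ (j : Fin t) → ∃ λ (i : Fin n) → a i ≈ cs j)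

  InRestrictedSum : ∀ {n} → List Carrier → (Fin n → Carrier) → Carrier → Set (c ⊔ ℓ)
  InRestrictedSum {n} A a s =
    ∃ λ (x : Fin n → Carrier) →
      (∀ i → x i ∈ A) × (∀ i j → x i ≈ x j → i ≡ j) × (s ≈ sum (λ i → a i * x i))

  AtLeast : ℕ → (Carrier → Set (c ⊔ ℓ)) → Set (c ⊔ ℓ)
  AtLeast m P =
    ∃ λ (f : Fin m → Carrier) → (∀ k l → f k ≈ f l → k ≡ l) × (∀ k → P (f k))

{-# OPTIONS --safe #-}
module Submission where

-- Put K = |A| − 1 and let φ be the divided difference over A: it kills xᵐ for m < K and maps x^K to 1, and so
-- does its n-fold tensor power T on each coordinate. Let h(x) = Σ aᵢxᵢ and let pᵢ be the number of j > i with
-- aⱼ = aᵢ. The function u(x) = ∏ xᵢ^pᵢ · V(x), V the Vandermonde determinant, vanishes unless the xᵢ are distinct,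
-- and it is homogeneous of degree nK − d. Hence T(hʲ u) = 0 for j < d. By the multinomial theorem T(h^d u) is, up to
-- a nonzero factor, d! times a confluent Vandermonde determinant whose i-th row is the pᵢ-th derivative of y^K,
-- (y^K)′, (y^K)″, … at y = aᵢ, and this determinant is nonzero. If sums s₁, …, sₘ with m ≤ d are already known, then
-- T(h^(d−m) ∏(h − sᵢ) u) = T(h^d u) ≠ 0, so some tuple of distinct elements of A has a sum different from all of them.

open import Defs
open import Level using (Lift; _⊔_)
import Algebra.Solver.Ring as RingSolver
open import Algebra.Solver.Ring.AlmostCommutativeRing using (fromCommutativeRing; _-Raw-AlmostCommutative⟶_)
open import Data.Bool using (Bool; true; false)
open import Data.Empty using (⊥-elim)
open import Data.Fin as Fin using (Fin; zero; suc)
import Data.Fin.Properties as Finₚ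
open import Data.Integer as ℤ using (ℤ; +_; -[1+_]; _⊖_; _◃_; sign; ∣_∣)
import Data.Integer.Properties as ℤₚ
open import Data.List as List using (List; []; _∷_; length; downFrom)
open import Data.List.Properties using (length-downFrom)
import Data.List.Membership.Setoid as Membership
open import Data.List.Membership.Setoid.Properties using (∈-resp-≈; ∈-lookup)
open import Data.List.Relation.Unary.AllPairs using (_∷_)
open import Data.List.Relation.Unary.Any using (here; there)
open import Data.List.Relation.Unary.Unique.Setoid using (Unique)
open import Data.List.Relation.Unary.Unique.Setoid.Properties using (Unique[x∷xs]⇒x∉xs)
open import Data.Maybe using (Maybe; just; nothing)
open import Data.Nat as ℕ using (ℕ; zero; suc; z≤n; s≤s)
import Data.Nat.ListAction as ListAction
import Data.Nat.Properties as ℕₚ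
open import Data.Nat.Solver using (module +-*-Solver)
open import Data.Product using (∃; ∃₂; _×_; _,_; proj₁; proj₂)
open import Data.Sign as Sign using (Sign)
open import Data.Sum using (_⊎_; inj₁; inj₂)
open import Data.Unit using (⊤)
open import Data.Vec as Vec using (Vec; []; _∷_; lookup; _[_]%=_)
open import Function using (_∘_)
open import Relation.Binary using (tri<; tri≈; tri>)
open import Relation.Nullary using (¬_; Dec; yes; no; does)
open import Relation.Nullary.Decidable using (dec-true; dec-false)
import Relation.Binary.PropositionalEquality as ≡
open ≡ using (_≡_)

-- The exponents pᵢ answer repeated coefficients. With V alone, the determinant has one row per aᵢ,
-- and equal coefficients give equal rows. The factor xᵢ^pᵢ differentiates row i another pᵢ times,
-- which turns each block of equal values into a confluent block, at the price of one degree per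
-- pair of equal coefficients. What remains is nK - n(n-1)/2 - #{i < j : aᵢ = aⱼ}, that is, n(|A| -
-- n) plus the number of pairs i < j with aᵢ ≠ aⱼ; this is d.
--
-- The characteristic matters twice: d! must not vanish, nor may the integers up to K, which govern
-- the determinant. A bound above d covers both once K ≤ d, and K ≤ d can fail only if d = 0, where
-- a single sum suffices. The multinomial coefficients are never formed: their denominators (K -
-- eᵢ)! are cleared by a common factor, and a recursion in the power of h takes the place of the
-- expansion.

-- Counting: multiplicities, pairs, and the size of d

count≤n : ∀ {n} (P : Fin n → Bool) → count P ℕ.≤ n
count≤n {zero}  P = z≤n
count≤n {suc n} P with P zero
... | true  = s≤s (count≤n (P ∘ suc))
... | false = ℕₚ.m≤n⇒m≤1+n (count≤n (P ∘ suc))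

count-cong : ∀ {n} {P Q : Fin n → Bool} → (∀ i → P i ≡ Q i) → count P ≡ count Q
count-cong {zero}  P≡Q = ≡.refl
count-cong {suc n} {P} {Q} P≡Q with P zero | Q zero | P≡Q zero
... | true  | .true  | ≡.refl = ≡.cong suc (count-cong (P≡Q ∘ suc))
... | false | .false | ≡.refl = count-cong (P≡Q ∘ suc)

count-true : ∀ {n} (P : Fin (suc n) → Bool) → P zero ≡ true → count P ≡ suc (count (P ∘ suc))
count-true P P₀ rewrite P₀ = ≡.refl

count-false : ∀ {n} (P : Fin (suc n) → Bool) → P zero ≡ false → count P ≡ count (P ∘ suc)
count-false P P₀ rewrite P₀ = ≡.refl

record Increment {t} (j : Fin t) (m m′ : Fin t → ℕ) : Set where
  field
    at      : m j ≡ suc (m′ j)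
    outside : ∀ k → ¬ k ≡ j → m k ≡ m′ k

open Increment

sumℕ-cong : ∀ {t} {m m′ : Fin t → ℕ} → (∀ j → m j ≡ m′ j) → sumℕ m ≡ sumℕ m′
sumℕ-cong {zero}  m≡m′ = ≡.refl
sumℕ-cong {suc t} m≡m′ = ≡.cong₂ ℕ._+_ (m≡m′ zero) (sumℕ-cong (m≡m′ ∘ suc))

pairSum-cong : ∀ {t} {m m′ : Fin t → ℕ} → (∀ j → m j ≡ m′ j) → pairSum m ≡ pairSum m′
pairSum-cong {zero}  m≡m′ = ≡.refl
pairSum-cong {suc t} m≡m′ =
  ≡.cong₂ ℕ._+_ (≡.cong₂ ℕ._*_ (m≡m′ zero) (sumℕ-cong (m≡m′ ∘ suc))) (pairSum-cong (m≡m′ ∘ suc))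

Increment-tail : ∀ {t} {j : Fin t} {m m′ : Fin (suc t) → ℕ} → Increment (suc j) m m′ → Increment j (m ∘ suc) (m′ ∘ suc)
Increment-tail inc = record { at = at inc ; outside = λ k k≢j → outside inc (suc k) (k≢j ∘ Finₚ.suc-injective) }

sumℕ-increment : ∀ {t} (j : Fin t) {m m′} → Increment j m m′ → sumℕ m ≡ suc (sumℕ m′)
sumℕ-increment zero    inc = ≡.cong₂ ℕ._+_ (at inc) (sumℕ-cong λ k → outside inc (suc k) λ ())
sumℕ-increment (suc j) {m} {m′} inc =
  ≡.trans (≡.cong₂ ℕ._+_ (outside inc zero λ ()) (sumℕ-increment j (Increment-tail inc))) (ℕₚ.+-suc (m′ zero) _)

-- A new member of group `j` forms a pair with every old element outside that group. The term `m′ j`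
-- stands on the left to avoid truncated subtraction.
pairSum-increment : ∀ {t} (j : Fin t) {m m′} → Increment j m m′ → pairSum m ℕ.+ m′ j ≡ pairSum m′ ℕ.+ sumℕ m′
pairSum-increment zero {m} {m′} inc
  rewrite at inc | sumℕ-cong {m = m ∘ suc} {m′ = m′ ∘ suc} (λ k → outside inc (suc k) λ ())
        | pairSum-cong {m = m ∘ suc} {m′ = m′ ∘ suc} (λ k → outside inc (suc k) λ ()) =
  solve 3 (λ x s p → (s :+ x :* s) :+ p :+ x := x :* s :+ p :+ (x :+ s)) ≡.refl (m′ zero) (sumℕ (m′ ∘ suc)) (pairSum (m′ ∘ suc))
  where open +-*-Solver
pairSum-increment (suc j) {m} {m′} inc
  rewrite outside inc zero (λ ()) | sumℕ-increment j (Increment-tail inc) = begin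
    x ℕ.* suc s ℕ.+ pairSum (m ∘ suc) ℕ.+ m′ (suc j)      ≡⟨ ℕₚ.+-assoc (x ℕ.* suc s) _ _ ⟩
    x ℕ.* suc s ℕ.+ (pairSum (m ∘ suc) ℕ.+ m′ (suc j))    ≡⟨ ≡.cong (x ℕ.* suc s ℕ.+_) (pairSum-increment j (Increment-tail inc)) ⟩
    x ℕ.* suc s ℕ.+ (p ℕ.+ s)                             ≡⟨ solve 3 (λ x s p → x :* (con 1 :+ s) :+ (p :+ s) := x :* s :+ p :+ (x :+ s)) ≡.refl x s p ⟩
    x ℕ.* s ℕ.+ p ℕ.+ (x ℕ.+ s)                           ∎
  where
  open +-*-Solver
  open ≡.≡-Reasoning
  x = m′ zero
  s = sumℕ (m′ ∘ suc)
  p = pairSum (m′ ∘ suc)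

sumℕ-zero⇒pairSum-zero : ∀ {t} (m : Fin t → ℕ) → sumℕ m ≡ 0 → pairSum m ≡ 0
sumℕ-zero⇒pairSum-zero {zero}  m _   = ≡.refl
sumℕ-zero⇒pairSum-zero {suc t} m Σ≡0
  rewrite ℕₚ.m+n≡0⇒m≡0 (m zero) Σ≡0 = sumℕ-zero⇒pairSum-zero (m ∘ suc) (ℕₚ.m+n≡0⇒n≡0 (m zero) Σ≡0)

-- The two sides differ by `m ℕ.* n`.
sum≤1+product : ∀ m n → suc m ℕ.+ suc n ℕ.≤ suc (suc m ℕ.* suc n)
sum≤1+product m n = ≡.subst (suc m ℕ.+ suc n ℕ.≤_)
  (solve 2 (λ m n → (con 1 :+ m) :+ (con 1 :+ n) :+ m :* n := con 1 :+ (con 1 :+ m) :* (con 1 :+ n)) ≡.refl m n)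
  (ℕₚ.m≤m+n (suc m ℕ.+ suc n) (m ℕ.* n))
  where open +-*-Solver

-- With two nonempty groups, `sum≤1+product` applies to the first nonempty group and the union of
-- the later ones; otherwise there are no pairs at all.
pairSum-dichotomy : ∀ {t} (m : Fin t → ℕ) → pairSum m ≡ 0 ⊎ sumℕ m ℕ.≤ suc (pairSum m)
pairSum-dichotomy {zero}  m = inj₁ ≡.refl
pairSum-dichotomy {suc t} m with m zero | sumℕ (m ∘ suc) in Σ | pairSum-dichotomy (m ∘ suc)
... | zero  | _     | ih = ih
... | suc x | zero  | _  = inj₁ (≡.trans (≡.cong (ℕ._+ pairSum (m ∘ suc)) (ℕₚ.*-zeroʳ x)) (sumℕ-zero⇒pairSum-zero (m ∘ suc) Σ))
... | suc x | suc y | _  = inj₂ (ℕₚ.≤-trans (sum≤1+product x y) (s≤s (ℕₚ.m≤m+n _ _)))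

-- When n = |A| and all aᵢ are equal, d = 0 and nothing forces char F ≥ |A|, so the factorials below may vanish.
degree-dichotomy : ∀ {t} (m : Fin t → ℕ) n N → sumℕ m ≡ n → n ℕ.≤ N →
                   let d = n ℕ.* (N ℕ.∸ n) ℕ.+ pairSum m in d ≡ 0 ⊎ (1 ℕ.≤ N × N ℕ.≤ suc d)
degree-dichotomy m zero    N Σ≡n _   = inj₁ (sumℕ-zero⇒pairSum-zero m Σ≡n)
degree-dichotomy m (suc n) N Σ≡n n≤N with pairSum-dichotomy m | N ℕ.∸ suc n in gap
... | inj₁ ps≡0 | zero  = inj₁ (≡.trans (≡.cong (ℕ._+ pairSum m) (ℕₚ.*-zeroʳ n)) ps≡0)
... | inj₁ _    | suc g = inj₂ (ℕₚ.≤-trans (s≤s z≤n) n≤N , (begin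
  N                                  ≡⟨ ℕₚ.m+[n∸m]≡n n≤N ⟨
  suc n ℕ.+ (N ℕ.∸ suc n)            ≡⟨ ≡.cong (suc n ℕ.+_) gap ⟩
  suc n ℕ.+ suc g                    ≤⟨ sum≤1+product n g ⟩
  suc (suc n ℕ.* suc g)              ≤⟨ s≤s (ℕₚ.m≤m+n _ _) ⟩
  suc (suc n ℕ.* suc g ℕ.+ pairSum m) ∎))
  where open ℕₚ.≤-Reasoning
... | inj₂ Σ≤   | g     = inj₂ (ℕₚ.≤-trans (s≤s z≤n) n≤N , (begin
  N                                  ≡⟨ ℕₚ.m+[n∸m]≡n n≤N ⟨
  suc n ℕ.+ (N ℕ.∸ suc n)            ≡⟨ ≡.cong₂ ℕ._+_ (≡.sym Σ≡n) gap ⟩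
  sumℕ m ℕ.+ g                       ≤⟨ ℕₚ.+-mono-≤ Σ≤ (ℕₚ.m≤m+n g (n ℕ.* g)) ⟩
  suc (pairSum m) ℕ.+ suc n ℕ.* g    ≡⟨ ≡.cong suc (ℕₚ.+-comm (pairSum m) _) ⟩
  suc (suc n ℕ.* g ℕ.+ pairSum m)    ∎))
  where open ℕₚ.≤-Reasoning

double-sum-downFrom : ∀ n → ListAction.sum (downFrom n) ℕ.+ ListAction.sum (downFrom n) ℕ.+ n ≡ n ℕ.* n
double-sum-downFrom zero    = ≡.refl
double-sum-downFrom (suc n) = begin
  n ℕ.+ s ℕ.+ (n ℕ.+ s) ℕ.+ suc n       ≡⟨ solve 2 (λ n s → n :+ s :+ (n :+ s) :+ (con 1 :+ n) := (con 1 :+ n) :+ n :+ (s :+ s :+ n)) ≡.refl n s ⟩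
  suc n ℕ.+ n ℕ.+ (s ℕ.+ s ℕ.+ n)       ≡⟨ ≡.cong (suc n ℕ.+ n ℕ.+_) (double-sum-downFrom n) ⟩
  suc n ℕ.+ n ℕ.+ n ℕ.* n               ≡⟨ solve 1 (λ n → (con 1 :+ n) :+ n :+ n :* n := (con 1 :+ n) :* (con 1 :+ n)) ≡.refl n ⟩
  suc n ℕ.* suc n                       ∎
  where
  open +-*-Solver
  open ≡.≡-Reasoning
  s = ListAction.sum (downFrom n)

-- Here `r` is Σ pᵢ and `q` counts pairs of different values, so the left side is deg u + d. Adding
-- `n` to both sides completes n(n-1) to a square and lets the truncated subtraction cancel.
degree-count : ∀ n K q r → n ℕ.≤ suc K → q ℕ.+ r ≡ ListAction.sum (downFrom n) →
               r ℕ.+ ListAction.sum (downFrom n) ℕ.+ (n ℕ.* (suc K ℕ.∸ n) ℕ.+ q) ≡ n ℕ.* K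
degree-count n K q r n≤K q+r≡s = ℕₚ.+-cancelˡ-≡ n _ _ (begin
  n ℕ.+ (r ℕ.+ s ℕ.+ (n ℕ.* g ℕ.+ q))     ≡⟨ solve 5 (λ n r s x q → n :+ (r :+ s :+ (x :+ q)) := x :+ (q :+ r :+ s :+ n)) ≡.refl n r s (n ℕ.* g) q ⟩
  n ℕ.* g ℕ.+ (q ℕ.+ r ℕ.+ s ℕ.+ n)       ≡⟨ ≡.cong (λ z → n ℕ.* g ℕ.+ (z ℕ.+ s ℕ.+ n)) q+r≡s ⟩
  n ℕ.* g ℕ.+ (s ℕ.+ s ℕ.+ n)             ≡⟨ ≡.cong (n ℕ.* g ℕ.+_) (double-sum-downFrom n) ⟩
  n ℕ.* g ℕ.+ n ℕ.* n                     ≡⟨ ℕₚ.*-distribˡ-+ n g n ⟨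
  n ℕ.* (g ℕ.+ n)                         ≡⟨ ≡.cong (n ℕ.*_) (ℕₚ.m∸n+n≡m n≤K) ⟩
  n ℕ.* suc K                             ≡⟨ ℕₚ.*-suc n K ⟩
  n ℕ.+ n ℕ.* K                           ∎)
  where
  open +-*-Solver
  open ≡.≡-Reasoning
  s = ListAction.sum (downFrom n)
  g = suc K ℕ.∸ n

-- Multiplicities of the coefficients

module Multiplicities {c ℓ} (F : Field c ℓ) where
  open FieldDefs F hiding (zero)

  mult-cong : ∀ {n} (a : Fin n → Carrier) {v w} → v ≈ w → mult a v ≡ mult a w
  mult-cong a {v} {w} v≈w = count-cong λ i → does-≡ (a i ≟ v) (a i ≟ w) (λ e → trans e v≈w) (λ e → trans e (sym v≈w))
    where
    does-≡ : ∀ {P Q : Set ℓ} (P? : Dec P) (Q? : Dec Q) → (P → Q) → (Q → P) → does P? ≡ does Q?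
    does-≡ (yes _)  (yes _)  _ _ = ≡.refl
    does-≡ (yes p)  (no ¬q)  f _ = ⊥-elim (¬q (f p))
    does-≡ (no ¬p)  (yes q)  _ g = ⊥-elim (¬p (g q))
    does-≡ (no _)   (no _)   _ _ = ≡.refl

  -- The exponents pᵢ. Along a block of μ equal values they run through μ - 1, ..., 0, the
  -- derivative orders of a confluent Vandermonde block.
  laterOccurrences : ∀ {n} → (Fin n → Carrier) → Fin n → ℕ
  laterOccurrences a zero    = mult (a ∘ suc) (a zero)
  laterOccurrences a (suc i) = laterOccurrences (a ∘ suc) i

  module _ {t} (cs : Fin t → Carrier) (cs-injective : ∀ j k → cs j ≈ cs k → j ≡ k) where

    multiplicities : ∀ {n} → (Fin n → Carrier) → Fin t → ℕ
    multiplicities a j = mult a (cs j)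

    multiplicities-increment : ∀ {n} (a : Fin (suc n) → Carrier) {j} → a zero ≈ cs j →
                               Increment j (multiplicities a) (multiplicities (a ∘ suc))
    multiplicities-increment a {j} a₀≈cⱼ = record
      { at      = count-true (λ i → does (a i ≟ cs j)) (dec-true (a zero ≟ cs j) a₀≈cⱼ)
      ; outside = λ k k≢j → count-false (λ i → does (a i ≟ cs k))
          (dec-false (a zero ≟ cs k) λ a₀≈cₖ → k≢j (cs-injective k j (trans (sym a₀≈cₖ) a₀≈cⱼ)))
      }

    sumℕ-multiplicities : ∀ {n} (a : Fin n → Carrier) → (∀ i → ∃ λ j → a i ≈ cs j) → sumℕ (multiplicities a) ≡ n
    sumℕ-multiplicities {zero}  a _     = sumℕ-zeros t
      where
      sumℕ-zeros : ∀ t → sumℕ {t} (λ _ → 0) ≡ 0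
      sumℕ-zeros zero    = ≡.refl
      sumℕ-zeros (suc t) = sumℕ-zeros t
    sumℕ-multiplicities {suc n} a cover =
      ≡.trans (sumℕ-increment (proj₁ (cover zero)) (multiplicities-increment a (proj₂ (cover zero))))
              (≡.cong suc (sumℕ-multiplicities (a ∘ suc) (cover ∘ suc)))

    -- Each of the n(n-1)/2 pairs of positions carries two different values, counted by `pairSum`,
    -- or two equal ones, counted at the earlier position.
    pairSum-multiplicities : ∀ {n} (a : Fin n → Carrier) → (∀ i → ∃ λ j → a i ≈ cs j) →
      pairSum (multiplicities a) ℕ.+ sumℕ (laterOccurrences a) ≡ ListAction.sum (downFrom n)
    pairSum-multiplicities {zero}  a _ =
      ≡.trans (ℕₚ.+-identityʳ _) (sumℕ-zero⇒pairSum-zero (multiplicities a) (sumℕ-multiplicities a λ ()))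
    pairSum-multiplicities {suc n} a cover = begin
      pairSum (multiplicities a) ℕ.+ (mult (a ∘ suc) (a zero) ℕ.+ l)
        ≡⟨ ≡.cong (λ x → pairSum (multiplicities a) ℕ.+ (x ℕ.+ l)) (mult-cong (a ∘ suc) a₀≈cⱼ) ⟩
      pairSum (multiplicities a) ℕ.+ (multiplicities (a ∘ suc) j ℕ.+ l)
        ≡⟨ ℕₚ.+-assoc (pairSum (multiplicities a)) _ _ ⟨
      pairSum (multiplicities a) ℕ.+ multiplicities (a ∘ suc) j ℕ.+ l
        ≡⟨ ≡.cong (ℕ._+ l) (pairSum-increment j (multiplicities-increment a a₀≈cⱼ)) ⟩
      pairSum (multiplicities (a ∘ suc)) ℕ.+ sumℕ (multiplicities (a ∘ suc)) ℕ.+ l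
        ≡⟨ ≡.cong (λ x → pairSum (multiplicities (a ∘ suc)) ℕ.+ x ℕ.+ l) (sumℕ-multiplicities (a ∘ suc) (cover ∘ suc)) ⟩
      pairSum (multiplicities (a ∘ suc)) ℕ.+ n ℕ.+ l
        ≡⟨ solve 3 (λ p n l → p :+ n :+ l := n :+ (p :+ l)) ≡.refl (pairSum (multiplicities (a ∘ suc))) n l ⟩
      n ℕ.+ (pairSum (multiplicities (a ∘ suc)) ℕ.+ l)
        ≡⟨ ≡.cong (n ℕ.+_) (pairSum-multiplicities (a ∘ suc) (cover ∘ suc)) ⟩
      n ℕ.+ ListAction.sum (downFrom n) ∎
      where
      open ≡.≡-Reasoning
      open +-*-Solver
      j = proj₁ (cover zero)
      a₀≈cⱼ = proj₂ (cover zero)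
      l = sumℕ (laterOccurrences (a ∘ suc))

-- Field arithmetic and a ring solver with integer coefficients

module FieldArithmetic {c ℓ} (F : Field c ℓ) where
  open FieldDefs F hiding (zero) public
  open import Algebra.Properties.Ring ring public
    using (-0#≈0#; -1*x≈-x; -‿involutive)
  open import Algebra.Properties.AbelianGroup +-abelianGroup public using (⁻¹-∙-comm) renaming (x≈y⇒x∙y⁻¹≈ε to x≈y⇒x-y≈0; x∙y⁻¹≈ε⇒x≈y to x-y≈0⇒x≈y)
  open import Algebra.Properties.Semiring.Mult semiring public using (×-homo-+; ×1-homo-*) renaming (_×_ to _×ₙ_)
  open import Algebra.Properties.Semiring.Exp semiring public using (_^_; ^-congˡ; ^-homo-*)
  open import Algebra.Properties.Semiring.Sum semiring public using (sum; sum-cong-≋; *-distribˡ-sum)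
  open import Relation.Binary.Reasoning.Setoid setoid public

  ι : ℕ → Carrier
  ι n = n ×ₙ 1#

  ι-+ : ∀ m n → ι (m ℕ.+ n) ≈ ι m + ι n
  ι-+ = ×-homo-+ 1#

  module IntegerCoefficients where
    ⟦_⟧ : ℤ → Carrier
    ⟦ + n ⟧      = ι n
    ⟦ -[1+ n ] ⟧ = - ι (suc n)

    ⊖-homo : ∀ m n → ⟦ m ⊖ n ⟧ ≈ ι m - ι n
    ⊖-homo m       zero    = sym (trans (+-congˡ -0#≈0#) (+-identityʳ _))
    ⊖-homo zero    (suc n) = sym (+-identityˡ _)
    ⊖-homo (suc m) (suc n) rewrite ℤₚ.[1+m]⊖[1+n]≡m⊖n m n = begin
      ⟦ m ⊖ n ⟧                      ≈⟨ ⊖-homo m n ⟩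
      ι m - ι n                      ≈⟨ +-congʳ (+-identityˡ _) ⟨
      0# + ι m - ι n                 ≈⟨ +-congʳ (+-congʳ (-‿inverseʳ 1#)) ⟨
      1# - 1# + ι m - ι n            ≈⟨ +-congʳ (+-assoc _ _ _) ⟩
      1# + (- 1# + ι m) - ι n        ≈⟨ +-congʳ (+-congˡ (+-comm _ _)) ⟩
      1# + (ι m - 1#) - ι n          ≈⟨ +-congʳ (+-assoc _ _ _) ⟨
      1# + ι m - 1# - ι n            ≈⟨ +-assoc _ _ _ ⟩
      ι (suc m) + (- 1# - ι n)       ≈⟨ +-congˡ (⁻¹-∙-comm _ _) ⟩
      ι (suc m) - ι (suc n)          ∎

    +-homo : ∀ i j → ⟦ i ℤ.+ j ⟧ ≈ ⟦ i ⟧ + ⟦ j ⟧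
    +-homo -[1+ m ] -[1+ n ] = begin
      - ι (suc (suc (m ℕ.+ n)))      ≡⟨ ≡.cong (λ k → - ι (suc k)) (ℕₚ.+-suc m n) ⟨
      - ι (suc m ℕ.+ suc n)          ≈⟨ -‿cong (ι-+ (suc m) (suc n)) ⟩
      - (ι (suc m) + ι (suc n))      ≈⟨ ⁻¹-∙-comm _ _ ⟨
      - ι (suc m) - ι (suc n)        ∎
    +-homo -[1+ m ] (+ n)    = trans (⊖-homo n (suc m)) (+-comm _ _)
    +-homo (+ m)    -[1+ n ] = ⊖-homo m (suc n)
    +-homo (+ m)    (+ n)    = ι-+ m n

    ⟦_⟧ₛ : Sign → Carrier
    ⟦ Sign.+ ⟧ₛ = 1#
    ⟦ Sign.- ⟧ₛ = - 1#

    sign-homo : ∀ s t → ⟦ s Sign.* t ⟧ₛ ≈ ⟦ s ⟧ₛ * ⟦ t ⟧ₛ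
    sign-homo Sign.+ t      = sym (*-identityˡ _)
    sign-homo Sign.- Sign.+ = sym (*-identityʳ _)
    sign-homo Sign.- Sign.- = sym (trans (-1*x≈-x (- 1#)) (-‿involutive 1#))

    ◃-homo : ∀ s n → ⟦ s ◃ n ⟧ ≈ ⟦ s ⟧ₛ * ι n
    ◃-homo s      zero    = sym (zeroʳ _)
    ◃-homo Sign.+ (suc n) = sym (*-identityˡ _)
    ◃-homo Sign.- (suc n) = sym (-1*x≈-x _)

    sign-abs : ∀ i → ⟦ i ⟧ ≈ ⟦ sign i ⟧ₛ * ι ∣ i ∣
    sign-abs (+ n)    = sym (*-identityˡ _)
    sign-abs -[1+ n ] = sym (-1*x≈-x _)

    open import Algebra.Properties.CommutativeSemigroup *-commutativeSemigroup using (interchange)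

    *-homo : ∀ i j → ⟦ i ℤ.* j ⟧ ≈ ⟦ i ⟧ * ⟦ j ⟧
    *-homo i j = begin
      ⟦ sign i Sign.* sign j ◃ ∣ i ∣ ℕ.* ∣ j ∣ ⟧                   ≈⟨ ◃-homo (sign i Sign.* sign j) (∣ i ∣ ℕ.* ∣ j ∣) ⟩
      ⟦ sign i Sign.* sign j ⟧ₛ * ι (∣ i ∣ ℕ.* ∣ j ∣)              ≈⟨ *-cong (sign-homo (sign i) (sign j)) (×1-homo-* ∣ i ∣ ∣ j ∣) ⟩
      (⟦ sign i ⟧ₛ * ⟦ sign j ⟧ₛ) * (ι ∣ i ∣ * ι ∣ j ∣)            ≈⟨ interchange _ _ _ _ ⟩
      (⟦ sign i ⟧ₛ * ι ∣ i ∣) * (⟦ sign j ⟧ₛ * ι ∣ j ∣)            ≈⟨ *-cong (sign-abs i) (sign-abs j) ⟨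
      ⟦ i ⟧ * ⟦ j ⟧                                              ∎

    neg-homo : ∀ i → ⟦ ℤ.- i ⟧ ≈ - ⟦ i ⟧
    neg-homo -[1+ n ]    = sym (-‿involutive _)
    neg-homo (+ zero)    = sym -0#≈0#
    neg-homo (+ (suc n)) = refl

    morphism : ℤ.+-*-rawRing -Raw-AlmostCommutative⟶ fromCommutativeRing commutativeRing
    morphism = record
      { ⟦_⟧ = ⟦_⟧ ; +-homo = +-homo ; *-homo = *-homo ; -‿homo = neg-homo
      ; 0-homo = refl ; 1-homo = +-identityʳ 1# }

    _coeff≟_ : ∀ i j → Maybe (⟦ i ⟧ ≈ ⟦ j ⟧)
    i coeff≟ j with i ℤ.≟ j
    ... | yes i≡j = just (reflexive (≡.cong ⟦_⟧ i≡j))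
    ... | no  _   = nothing

  open RingSolver ℤ.+-*-rawRing (fromCommutativeRing commutativeRing)
    IntegerCoefficients.morphism IntegerCoefficients._coeff≟_ public
    using (solve; _:=_; _:+_; _:*_; _:-_; :-_; con)

  *-cancel-0 : ∀ {x y} → ¬ x ≈ 0# → x * y ≈ 0# → y ≈ 0#
  *-cancel-0 {x} {y} x≉0 xy≈0 with inverse x x≉0
  ... | z , xz≈1 = begin
    y             ≈⟨ *-identityˡ y ⟨
    1# * y        ≈⟨ *-congʳ xz≈1 ⟨
    x * z * y     ≈⟨ solve 3 (λ x y z → x :* z :* y := z :* (x :* y)) refl x y z ⟩
    z * (x * y)   ≈⟨ *-congˡ xy≈0 ⟩
    z * 0#        ≈⟨ zeroʳ z ⟩
    0#            ∎

  *-≉0 : ∀ {x y} → ¬ x ≈ 0# → ¬ y ≈ 0# → ¬ x * y ≈ 0#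
  *-≉0 x≉0 y≉0 xy≈0 = y≉0 (*-cancel-0 x≉0 xy≈0)

  ≉0-≈ : ∀ {x y} → x ≈ y → ¬ x ≈ 0# → ¬ y ≈ 0#
  ≉0-≈ x≈y x≉0 y≈0 = x≉0 (trans x≈y y≈0)

  -- The default 0 at 0 makes `inv` total, so divided differences are defined and linear for any
  -- list of nodes; distinctness enters only when their values are computed.
  inv : Carrier → Carrier
  inv x with x ≟ 0#
  ... | yes _  = 0#
  ... | no x≉0 = proj₁ (inverse x x≉0)

  inv-inverseʳ : ∀ {x} → ¬ x ≈ 0# → x * inv x ≈ 1#
  inv-inverseʳ {x} x≉0 with x ≟ 0#
  ... | yes x≈0  = ⊥-elim (x≉0 x≈0)
  ... | no  x≉0′ = proj₂ (inverse x x≉0′)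

  inv-≉0 : ∀ {x} → ¬ x ≈ 0# → ¬ inv x ≈ 0#
  inv-≉0 x≉0 ix≈0 = 1≉0 (trans (sym (inv-inverseʳ x≉0)) (trans (*-congˡ ix≈0) (zeroʳ _)))

  -- The witness chosen by `inverse` is not assumed to respect `≈`; this identity yields both
  -- congruence and injectivity of `inv`.
  inv-difference : ∀ {x y} → ¬ x ≈ 0# → ¬ y ≈ 0# → inv x - inv y ≈ inv x * inv y * (y - x)
  inv-difference {x} {y} x≉0 y≉0 = begin
    inv x - inv y                                        ≈⟨ +-cong (*-identityʳ _) (-‿cong (*-identityʳ _)) ⟨
    inv x * 1# - inv y * 1#                              ≈⟨ +-cong (*-congˡ (inv-inverseʳ y≉0)) (-‿cong (*-congˡ (inv-inverseʳ x≉0))) ⟨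
    inv x * (y * inv y) - inv y * (x * inv x)            ≈⟨ solve 4 (λ x y u v → u :* (y :* v) :- v :* (x :* u) := u :* v :* (y :- x)) refl x y (inv x) (inv y) ⟩
    inv x * inv y * (y - x)                              ∎

  inv-cong : ∀ {x y} → ¬ x ≈ 0# → ¬ y ≈ 0# → x ≈ y → inv x ≈ inv y
  inv-cong x≉0 y≉0 x≈y = x-y≈0⇒x≈y _ _ (trans (inv-difference x≉0 y≉0) (trans (*-congˡ (x≈y⇒x-y≈0 (sym x≈y))) (zeroʳ _)))

  inv-injective : ∀ {x y} → ¬ x ≈ 0# → ¬ y ≈ 0# → inv x ≈ inv y → x ≈ y
  inv-injective x≉0 y≉0 ix≈iy = sym (x-y≈0⇒x≈y _ _
    (*-cancel-0 (*-≉0 (inv-≉0 x≉0) (inv-≉0 y≉0)) (trans (sym (inv-difference x≉0 y≉0)) (x≈y⇒x-y≈0 ix≈iy))))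

  difference-≉0 : ∀ {x y} → ¬ x ≈ y → ¬ x - y ≈ 0#
  difference-≉0 x≉y x-y≈0 = x≉y (x-y≈0⇒x≈y _ _ x-y≈0)

-- Linear functionals: divided differences, tensor powers, moments

module LinearFunctionals {c ℓ} (F : Field c ℓ) where
  open FieldArithmetic F

  record IsLinear {X : Set c} (T : (X → Carrier) → Carrier) : Set (c ⊔ ℓ) where
    field
      T-cong : ∀ {f g} → (∀ x → f x ≈ g x) → T f ≈ T g
      T-+    : ∀ f g → T (λ x → f x + g x) ≈ T f + T g
      T-*    : ∀ k f → T (λ x → k * f x) ≈ k * T f

    T-*ʳ : ∀ k f → T (λ x → f x * k) ≈ T f * k
    T-*ʳ k f = trans (T-cong λ x → *-comm _ _) (trans (T-* k f) (*-comm _ _))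

    T-0 : T (λ _ → 0#) ≈ 0#
    T-0 = trans (T-cong λ _ → sym (zeroˡ 0#)) (trans (T-* 0# (λ _ → 0#)) (zeroˡ _))

    T-sub : ∀ f g → T (λ x → f x - g x) ≈ T f - T g
    T-sub f g = begin
      T (λ x → f x - g x)            ≈⟨ T-cong (λ x → +-congˡ (sym (-1*x≈-x (g x)))) ⟩
      T (λ x → f x + - 1# * g x)     ≈⟨ T-+ f (λ x → - 1# * g x) ⟩
      T f + T (λ x → - 1# * g x)     ≈⟨ +-congˡ (trans (T-* (- 1#) g) (-1*x≈-x (T g))) ⟩
      T f - T g                      ∎

    T-sum : ∀ {n} (f : Fin n → X → Carrier) → T (λ x → sum (λ i → f i x)) ≈ sum (λ i → T (f i))
    T-sum {zero}  f = T-0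
    T-sum {suc n} f = trans (T-+ (f zero) (λ x → sum (λ i → f (suc i) x))) (+-congˡ (T-sum (f ∘ suc)))

  open IsLinear

  module DividedDifferences where
    open Membership setoid using (_∈_)

    quotient : Carrier → (Carrier → Carrier) → Carrier → Carrier
    quotient y f x = inv (x - y) * (f x - f y)

    dividedDifference : Carrier → List Carrier → (Carrier → Carrier) → Carrier
    dividedDifference y []      f = f y
    dividedDifference y (z ∷ B) f = dividedDifference z B (quotient y f)

    -- Agreement on the nodes is all that can be asked: at `x = y` the function `quotient y f` has a
    -- default value, and identities for it hold only elsewhere.
    dividedDifference-cong : ∀ y B {f g} → (∀ {x} → x ∈ y ∷ B → f x ≈ g x) →
                             dividedDifference y B f ≈ dividedDifference y B g
    dividedDifference-cong y []      f≈g = f≈g (here refl)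
    dividedDifference-cong y (z ∷ B) f≈g = dividedDifference-cong z B λ x∈ →
      *-congˡ (+-cong (f≈g (there x∈)) (-‿cong (f≈g (here refl))))

    dividedDifference-linear : ∀ y B → IsLinear (dividedDifference y B)
    dividedDifference-linear y [] = record
      { T-cong = λ f≈g → f≈g y ; T-+ = λ _ _ → refl ; T-* = λ _ _ → refl }
    dividedDifference-linear y (z ∷ B) = record
      { T-cong = λ f≈g → T-cong L λ x → *-congˡ (+-cong (f≈g x) (-‿cong (f≈g y)))
      ; T-+    = λ f g → trans
          (T-cong L λ x → solve 5 (λ i a b c d → i :* ((a :+ b) :- (c :+ d)) := i :* (a :- c) :+ i :* (b :- d))
            refl (inv (x - y)) (f x) (g x) (f y) (g y))
          (T-+ L (quotient y f) (quotient y g))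
      ; T-*    = λ k f → trans
          (T-cong L λ x → solve 4 (λ i k a b → i :* (k :* a :- k :* b) := k :* (i :* (a :- b)))
            refl (inv (x - y)) k (f x) (f y))
          (T-* L k (quotient y f))
      }
      where L = dividedDifference-linear z B

    -- From x^(m+1) - y^(m+1) = (x - y)x^m + y(x^m - y^m). This is the recurrence of the complete
    -- homogeneous symmetric polynomials, whose values at the nodes are the divided differences of
    -- powers.
    dividedDifference-^-suc : ∀ y z B → Unique setoid (y ∷ z ∷ B) → ∀ m →
      dividedDifference y (z ∷ B) (_^ suc m) ≈
      dividedDifference z B (_^ m) + y * dividedDifference y (z ∷ B) (_^ m)
    dividedDifference-^-suc y z B unique m = begin
      dividedDifference z B (quotient y (_^ suc m))
        ≈⟨ dividedDifference-cong z B pointwise ⟩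
      dividedDifference z B (λ x → x ^ m + y * quotient y (_^ m) x)
        ≈⟨ T-+ L (_^ m) (λ x → y * quotient y (_^ m) x) ⟩
      dividedDifference z B (_^ m) + dividedDifference z B (λ x → y * quotient y (_^ m) x)
        ≈⟨ +-congˡ (T-* L y (quotient y (_^ m))) ⟩
      dividedDifference z B (_^ m) + y * dividedDifference z B (quotient y (_^ m)) ∎
      where
      L = dividedDifference-linear z B
      pointwise : ∀ {x} → x ∈ z ∷ B → quotient y (_^ suc m) x ≈ x ^ m + y * quotient y (_^ m) x
      pointwise {x} x∈ = begin
        inv (x - y) * (x * x ^ m - y * y ^ m)
          ≈⟨ solve 5 (λ i x y a b → i :* (x :* a :- y :* b) := (x :- y) :* i :* a :+ y :* (i :* (a :- b)))
               refl (inv (x - y)) x y (x ^ m) (y ^ m) ⟩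
        (x - y) * inv (x - y) * x ^ m + y * quotient y (_^ m) x
          ≈⟨ +-congʳ (trans (*-congʳ (inv-inverseʳ (difference-≉0 x≉y))) (*-identityˡ _)) ⟩
        x ^ m + y * quotient y (_^ m) x ∎
        where
        x≉y : ¬ x ≈ y
        x≉y x≈y = Unique[x∷xs]⇒x∉xs setoid unique (∈-resp-≈ setoid x≈y x∈)

    dividedDifference-low : ∀ y B → Unique setoid (y ∷ B) → ∀ {m} → m ℕ.< length B →
                            dividedDifference y B (_^ m) ≈ 0#
    dividedDifference-low y (z ∷ B) unique {zero} _ =
      trans (T-cong (dividedDifference-linear z B) λ x → trans (*-congˡ (-‿inverseʳ 1#)) (zeroʳ _))
            (T-0 (dividedDifference-linear z B))
    dividedDifference-low y (z ∷ B) unique@(_ ∷ unique′) {suc m} m<K@(ℕ.s≤s m<K′) =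
      trans (dividedDifference-^-suc y z B unique m)
      (trans (+-cong (dividedDifference-low z B unique′ m<K′)
                     (trans (*-congˡ (dividedDifference-low y (z ∷ B) unique (ℕₚ.<-trans (ℕₚ.n<1+n m) m<K))) (zeroʳ y)))
             (+-identityˡ 0#))

    dividedDifference-top : ∀ y B → Unique setoid (y ∷ B) → dividedDifference y B (_^ length B) ≈ 1#
    dividedDifference-top y []      _ = refl
    dividedDifference-top y (z ∷ B) unique@(_ ∷ unique′) =
      trans (dividedDifference-^-suc y z B unique (length B))
      (trans (+-cong (dividedDifference-top z B unique′)
                     (trans (*-congˡ (dividedDifference-low y (z ∷ B) unique ℕₚ.≤-refl)) (zeroʳ y)))
             (+-identityʳ 1#))

    -- If `f` vanishes at `y`, then a node where the quotient is nonzero is one where `f` is.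
    -- Deciding equality at each node turns nonvanishing into a witness.
    dividedDifference-search : ∀ y B {f} → ¬ dividedDifference y B f ≈ 0# → ∃ λ x → x ∈ y ∷ B × ¬ f x ≈ 0#
    dividedDifference-search y []      f≉0 = y , here refl , f≉0
    dividedDifference-search y (z ∷ B) {f} q≉0 with f y ≟ 0#
    ... | no  fy≉0 = y , here refl , fy≉0
    ... | yes fy≈0 with dividedDifference-search z B q≉0
    ...   | x , x∈ , qx≉0 = x , there x∈ , λ fx≈0 → qx≉0
      (trans (*-congˡ (x≈y⇒x-y≈0 (trans fx≈0 (sym fy≈0)))) (zeroʳ _))

  module Tensor (φ : (Carrier → Carrier) → Carrier) (φ-linear : IsLinear φ) where

    tensor : ∀ n → (Vec Carrier n → Carrier) → Carrier
    tensor zero    f = f []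
    tensor (suc n) f = φ (λ x → tensor n (λ xs → f (x ∷ xs)))

    tensor-linear : ∀ n → IsLinear (tensor n)
    tensor-linear zero    = record { T-cong = λ f≈g → f≈g [] ; T-+ = λ _ _ → refl ; T-* = λ _ _ → refl }
    tensor-linear (suc n) = record
      { T-cong = λ f≈g → T-cong φ-linear λ x → T-cong L λ xs → f≈g (x ∷ xs)
      ; T-+    = λ f g → trans (T-cong φ-linear λ x → T-+ L (λ xs → f (x ∷ xs)) (λ xs → g (x ∷ xs))) (T-+ φ-linear _ _)
      ; T-*    = λ k f → trans (T-cong φ-linear λ x → T-* L k (λ xs → f (x ∷ xs))) (T-* φ-linear k _)
      }
      where L = tensor-linear n

    tensor-search : ∀ {p} {P : Carrier → Set p} → (∀ {f} → ¬ φ f ≈ 0# → ∃ λ x → P x × ¬ f x ≈ 0#) →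
                    ∀ n {f} → ¬ tensor n f ≈ 0# →
                    ∃ λ (xs : Vec Carrier n) → (∀ i → P (lookup xs i)) × ¬ f xs ≈ 0#
    tensor-search search zero    f≉0 = [] , (λ ()) , f≉0
    tensor-search search (suc n) T≉0 with search T≉0
    ... | x , Px , Tx≉0 with tensor-search search n Tx≉0
    ...   | xs , Pxs , f≉0 = x ∷ xs , (λ { zero → Px ; (suc i) → Pxs i }) , f≉0

  rowProduct : ∀ {n} → (Fin n → ℕ → Carrier) → Vec ℕ n → Carrier
  rowProduct R []       = 1#
  rowProduct R (e ∷ es) = R zero e * rowProduct (R ∘ suc) es

  -- The step is cross-multiplied so that it serves both monomials, with k = 1 and l = xᵢ, and
  -- weights, with k = aᵢ and l = K - eᵢ.
  rowProduct-inc : ∀ {n} (R : Fin n → ℕ → Carrier) {k l} e i → k * R i (suc (lookup e i)) ≈ l * R i (lookup e i) →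
                   k * rowProduct R (e [ i ]%= suc) ≈ l * rowProduct R e
  rowProduct-inc R {k} {l} (e ∷ es) zero    step = trans (sym (*-assoc _ _ _)) (trans (*-congʳ step) (*-assoc _ _ _))
  rowProduct-inc R {k} {l} (e ∷ es) (suc i) step =
    trans (swap k _ _) (trans (*-congˡ (rowProduct-inc (R ∘ suc) es i step)) (sym (swap l _ _)))
    where
    swap : ∀ a b c → a * (b * c) ≈ b * (a * c)
    swap = solve 3 (λ a b c → a :* (b :* c) := b :* (a :* c)) refl

  sum-inc : ∀ {n} (e : Vec ℕ n) i → Vec.sum (e [ i ]%= suc) ≡ suc (Vec.sum e)
  sum-inc (e ∷ es) zero    = ≡.refl
  sum-inc (e ∷ es) (suc i) = ≡.trans (≡.cong (e ℕ.+_) (sum-inc es i)) (ℕₚ.+-suc e _)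

  monomial : ∀ {n} → Vec Carrier n → Vec ℕ n → Carrier
  monomial xs = rowProduct (λ i → lookup xs i ^_)

  dot : ∀ {n} → (Fin n → Carrier) → Vec Carrier n → Carrier
  dot a xs = sum (λ i → a i * lookup xs i)

  falling : Carrier → ℕ → Carrier
  falling x zero    = 1#
  falling x (suc p) = (x - ι p) * falling x p

  factorial : ℕ → Carrier
  factorial zero    = 1#
  factorial (suc j) = ι (suc j) * factorial j

  falling-vanishes : ∀ K {e} → K ℕ.< e → falling (ι K) e ≈ 0#
  falling-vanishes K {suc e} (ℕ.s≤s K≤e) with ℕₚ.m≤n⇒m<n∨m≡n K≤e
  ... | inj₁ K<e    = trans (*-congˡ (falling-vanishes K K<e)) (zeroʳ _)
  ... | inj₂ ≡.refl = trans (*-congʳ (-‿inverseʳ _)) (zeroˡ _)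

  -- With b = 1/a, this is a^(−K) times the e-th derivative of y^K at y = a.
  weight : ℕ → Carrier → ℕ → Carrier
  weight K b e = falling (ι K) e * b ^ e

  -- Moments of powers of h against monomials

  module Moments (K : ℕ) (φ : (Carrier → Carrier) → Carrier) (φ-linear : IsLinear φ)
                 (φ-low : ∀ {m} → m ℕ.< K → φ (_^ m) ≈ 0#) (φ-top : φ (_^ K) ≈ 1#) where
    open Tensor φ φ-linear

    moment : ∀ {n} → (Fin n → Carrier) → ℕ → Vec ℕ n → Carrier
    moment {n} a j e = tensor n (λ xs → dot a xs ^ j * monomial xs e)

    tensor-monomial : ∀ {n} (e : Vec ℕ n) → tensor n (λ xs → monomial xs e) ≈ rowProduct (λ _ m → φ (_^ m)) e
    tensor-monomial []       = refl
    tensor-monomial {suc n} (e ∷ es) = trans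
      (T-cong φ-linear λ x → trans (T-* (tensor-linear n) (x ^ e) (λ xs → monomial xs es)) (*-congˡ (tensor-monomial es)))
      (T-*ʳ φ-linear _ (_^ e))

    moment-zero : ∀ {n} (a : Fin n → Carrier) e → moment a 0 e ≈ rowProduct (λ _ m → φ (_^ m)) e
    moment-zero {n} a e = trans (T-cong (tensor-linear n) λ xs → *-identityˡ _) (tensor-monomial e)

    -- One factor h is spread over the monomial: its term aᵢxᵢ raises the i-th exponent. Iterated,
    -- this does the work of the multinomial theorem.
    moment-suc : ∀ {n} (a : Fin n → Carrier) j e → moment a (suc j) e ≈ sum (λ i → a i * moment a j (e [ i ]%= suc))
    moment-suc {n} a j e = begin
      tensor n (λ xs → dot a xs * dot a xs ^ j * monomial xs e)
        ≈⟨ T-cong L (λ xs → trans (solve 3 (λ a b c → a :* b :* c := b :* c :* a) refl _ _ _)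
             (trans (*-distribˡ-sum (dot a xs ^ j * monomial xs e) (λ i → a i * lookup xs i))
                    (sum-cong-≋ λ i → pointwise xs i))) ⟩
      tensor n (λ xs → sum (λ i → a i * (dot a xs ^ j * monomial xs (e [ i ]%= suc))))
        ≈⟨ T-sum L (λ i xs → a i * (dot a xs ^ j * monomial xs (e [ i ]%= suc))) ⟩
      sum (λ i → tensor n (λ xs → a i * (dot a xs ^ j * monomial xs (e [ i ]%= suc))))
        ≈⟨ sum-cong-≋ (λ i → T-* L (a i) (λ xs → dot a xs ^ j * monomial xs (e [ i ]%= suc))) ⟩
      sum (λ i → a i * moment a j (e [ i ]%= suc)) ∎
      where
      L = tensor-linear n
      pointwise : ∀ xs i → dot a xs ^ j * monomial xs e * (a i * lookup xs i) ≈
                           a i * (dot a xs ^ j * monomial xs (e [ i ]%= suc))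
      pointwise xs i = trans
        (solve 4 (λ d m a x → d :* m :* (a :* x) := a :* (d :* (x :* m))) refl _ _ _ _)
        (*-congˡ (*-congˡ (trans (sym (rowProduct-inc (λ i → lookup xs i ^_) e i (*-identityˡ _))) (*-identityˡ _))))

    -- By pigeonhole some exponent is below `K`.
    rowProduct-φ-low : ∀ {n} (e : Vec ℕ n) → Vec.sum e ℕ.< n ℕ.* K → rowProduct (λ _ m → φ (_^ m)) e ≈ 0#
    rowProduct-φ-low (e ∷ es) Σe<nK with e ℕₚ.<? K
    ... | yes e<K = trans (*-congʳ (φ-low e<K)) (zeroˡ _)
    ... | no  e≮K = trans (*-congˡ (rowProduct-φ-low es (ℕₚ.+-cancelˡ-< K _ _
                      (ℕₚ.≤-<-trans (ℕₚ.+-monoˡ-≤ (Vec.sum es) (ℕₚ.≮⇒≥ e≮K)) Σe<nK)))) (zeroʳ _)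

    moment-low : ∀ {n} (a : Fin n → Carrier) j e → Vec.sum e ℕ.+ j ℕ.< n ℕ.* K → moment a j e ≈ 0#
    moment-low {n} a zero    e low = trans (moment-zero a e) (rowProduct-φ-low e (≡.subst (ℕ._< n ℕ.* K) (ℕₚ.+-identityʳ _) low))
    moment-low {n} a (suc j) e low = trans (moment-suc a j e)
      (trans (sum-cong-≋ (λ i → trans (*-congˡ (moment-low a j (e [ i ]%= suc)
                (≡.subst (ℕ._< n ℕ.* K) (≡.trans (ℕₚ.+-suc (Vec.sum e) j) (≡.cong (ℕ._+ j) (≡.sym (sum-inc e i)))) low)))
                (zeroʳ (a i)))) (sum-zeros n))
      where
      sum-zeros : ∀ n → sum {n} (λ _ → 0#) ≈ 0#
      sum-zeros zero    = refl
      sum-zeros (suc n) = trans (+-identityˡ _) (sum-zeros n)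

    weight-suc : ∀ {a b} → a * b ≈ 1# → ∀ e → a * weight K b (suc e) ≈ (ι K - ι e) * weight K b e
    weight-suc {a} {b} ab≈1 e = begin
      a * ((ι K - ι e) * falling (ι K) e * (b * b ^ e))
        ≈⟨ solve 5 (λ a b k f p → a :* (k :* f :* (b :* p)) := a :* b :* (k :* (f :* p))) refl a b (ι K - ι e) (falling (ι K) e) (b ^ e) ⟩
      a * b * ((ι K - ι e) * weight K b e)
        ≈⟨ trans (*-congʳ ab≈1) (*-identityˡ _) ⟩
      (ι K - ι e) * weight K b e ∎

    weight-vanishes : ∀ b {e} → K ℕ.< e → weight K b e ≈ 0#
    weight-vanishes b K<e = trans (*-congʳ (falling-vanishes K K<e)) (zeroˡ _)

    rowProduct-weight-high : ∀ {n} (b : Fin n → Carrier) e → n ℕ.* K ℕ.< Vec.sum e → rowProduct (weight K ∘ b) e ≈ 0#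
    rowProduct-weight-high {suc n} b (e ∷ es) nK<Σe with K ℕₚ.<? e
    ... | yes K<e = trans (*-congʳ (weight-vanishes (b zero) K<e)) (zeroˡ _)
    ... | no  K≮e = trans (*-congˡ (rowProduct-weight-high (b ∘ suc) es (ℕₚ.+-cancelˡ-< K _ _
                      (ℕₚ.<-≤-trans nK<Σe (ℕₚ.+-monoˡ-≤ (Vec.sum es) (ℕₚ.≮⇒≥ K≮e)))))) (zeroʳ _)

    -- With b = 1/a this is ∏ K! aᵢ^(-K), the factor that clears the denominators (K - eᵢ)! of the
    -- multinomial coefficients.
    leading : ∀ {n} → (Fin n → Carrier) → Carrier
    leading {n} b = rowProduct (weight K ∘ b) (Vec.replicate n K)

    -- In total degree nK either every exponent is `K`, or one is below and another above: the first
    -- kills the left side through φ, the second kills the right side through the falling factorial.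
    leading-φ : ∀ {n} (b : Fin n → Carrier) e → Vec.sum e ≡ n ℕ.* K →
                leading b * rowProduct (λ _ m → φ (_^ m)) e ≈ rowProduct (weight K ∘ b) e
    leading-φ b [] _ = *-identityˡ _
    leading-φ {suc n} b (e ∷ es) Σe≡nK with ℕₚ.<-cmp e K
    ... | tri< e<K _ _ = trans (trans (*-congˡ (trans (*-congʳ (φ-low e<K)) (zeroˡ _))) (zeroʳ _))
      (sym (trans (*-congˡ (rowProduct-weight-high (b ∘ suc) es (ℕₚ.+-cancelˡ-< e _ _
        (≡.subst (e ℕ.+ n ℕ.* K ℕ.<_) (≡.sym Σe≡nK) (ℕₚ.+-monoˡ-< (n ℕ.* K) e<K))))) (zeroʳ _)))
    ... | tri> _ _ K<e = trans (trans (*-congˡ (trans (*-congˡ (rowProduct-φ-low es (ℕₚ.+-cancelˡ-< e _ _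
        (≡.subst (ℕ._< e ℕ.+ n ℕ.* K) (≡.sym Σe≡nK) (ℕₚ.+-monoˡ-< (n ℕ.* K) K<e))))) (zeroʳ _))) (zeroʳ _))
      (sym (trans (*-congʳ (weight-vanishes (b zero) K<e)) (zeroˡ _)))
    ... | tri≈ _ ≡.refl _ = begin
      weight K (b zero) K * leading (b ∘ suc) * (φ (_^ K) * rowProduct _ es)
        ≈⟨ solve 4 (λ w l p r → w :* l :* (p :* r) := p :* (w :* (l :* r))) refl _ _ _ _ ⟩
      φ (_^ K) * (weight K (b zero) K * (leading (b ∘ suc) * rowProduct _ es))
        ≈⟨ *-cong φ-top (*-congˡ (leading-φ (b ∘ suc) es (ℕₚ.+-cancelˡ-≡ K _ _ Σe≡nK))) ⟩
      1# * rowProduct (weight K ∘ b) (K ∷ es)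
        ≈⟨ *-identityˡ _ ⟩
      rowProduct (weight K ∘ b) (K ∷ es) ∎

    sum-deficits : ∀ {n} (e : Vec ℕ n) → sum (λ i → ι K - ι (lookup e i)) ≈ ι (n ℕ.* K) - ι (Vec.sum e)
    sum-deficits []       = sym (-‿inverseʳ 0#)
    sum-deficits {suc n} (e ∷ es) = begin
      (ι K - ι e) + sum (λ i → ι K - ι (lookup es i))      ≈⟨ +-congˡ (sum-deficits es) ⟩
      (ι K - ι e) + (ι (n ℕ.* K) - ι (Vec.sum es))         ≈⟨ solve 4 (λ k e m s → (k :- e) :+ (m :- s) := (k :+ m) :- (e :+ s)) refl _ _ _ _ ⟩
      (ι K + ι (n ℕ.* K)) - (ι e + ι (Vec.sum es))         ≈⟨ +-cong (ι-+ K _) (-‿cong (ι-+ e _)) ⟨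
      ι (suc n ℕ.* K) - ι (e ℕ.+ Vec.sum es)               ∎

    -- The multinomial formula j! ∏ aᵢ^(K-eᵢ)/(K-eᵢ)! times `leading b`. In the induction each
    -- summand contributes its deficit K - eᵢ, and the deficits add up to `suc j`, the new factor of
    -- the factorial.
    moment-top : ∀ {n} {a b : Fin n → Carrier} → (∀ i → a i * b i ≈ 1#) → ∀ j e → Vec.sum e ℕ.+ j ≡ n ℕ.* K →
                 leading b * moment a j e ≈ factorial j * rowProduct (weight K ∘ b) e
    moment-top {n} {a} {b} ab≈1 zero e Σe+j≡nK = trans (*-congˡ (moment-zero a e))
      (trans (leading-φ b e (≡.trans (≡.sym (ℕₚ.+-identityʳ _)) Σe+j≡nK)) (sym (*-identityˡ _)))
    moment-top {n} {a} {b} ab≈1 (suc j) e Σe+j≡nK = begin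
      leading b * moment a (suc j) e
        ≈⟨ *-congˡ (moment-suc a j e) ⟩
      leading b * sum (λ i → a i * moment a j (e [ i ]%= suc))
        ≈⟨ *-distribˡ-sum (leading b) (λ i → a i * moment a j (e [ i ]%= suc)) ⟩
      sum (λ i → leading b * (a i * moment a j (e [ i ]%= suc)))
        ≈⟨ sum-cong-≋ term ⟩
      sum (λ i → (factorial j * rowProduct (weight K ∘ b) e) * (ι K - ι (lookup e i)))
        ≈⟨ *-distribˡ-sum (factorial j * rowProduct (weight K ∘ b) e) (λ i → ι K - ι (lookup e i)) ⟨
      (factorial j * rowProduct (weight K ∘ b) e) * sum (λ i → ι K - ι (lookup e i))
        ≈⟨ *-congˡ (sum-deficits e) ⟩
      (factorial j * rowProduct (weight K ∘ b) e) * (ι (n ℕ.* K) - ι (Vec.sum e))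
        ≡⟨ ≡.cong (λ m → (factorial j * rowProduct (weight K ∘ b) e) * (ι m - ι (Vec.sum e))) Σe+j≡nK ⟨
      (factorial j * rowProduct (weight K ∘ b) e) * (ι (Vec.sum e ℕ.+ suc j) - ι (Vec.sum e))
        ≈⟨ *-congˡ (+-congʳ (ι-+ (Vec.sum e) (suc j))) ⟩
      (factorial j * rowProduct (weight K ∘ b) e) * (ι (Vec.sum e) + ι (suc j) - ι (Vec.sum e))
        ≈⟨ solve 4 (λ f r s t → (f :* r) :* (s :+ t :- s) := t :* f :* r) refl _ _ (ι (Vec.sum e)) (ι (suc j)) ⟩
      factorial (suc j) * rowProduct (weight K ∘ b) e ∎
      where
      swap : ∀ x y z → x * (y * z) ≈ y * (x * z)
      swap = solve 3 (λ x y z → x :* (y :* z) := y :* (x :* z)) refl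
      term : ∀ i → leading b * (a i * moment a j (e [ i ]%= suc)) ≈
                   (factorial j * rowProduct (weight K ∘ b) e) * (ι K - ι (lookup e i))
      term i = begin
        leading b * (a i * moment a j (e [ i ]%= suc))
          ≈⟨ swap _ _ _ ⟩
        a i * (leading b * moment a j (e [ i ]%= suc))
          ≈⟨ *-congˡ (moment-top ab≈1 j (e [ i ]%= suc)
               (≡.trans (≡.cong (ℕ._+ j) (sum-inc e i)) (≡.trans (≡.sym (ℕₚ.+-suc (Vec.sum e) j)) Σe+j≡nK))) ⟩
        a i * (factorial j * rowProduct (weight K ∘ b) (e [ i ]%= suc))
          ≈⟨ swap _ _ _ ⟩
        factorial j * (a i * rowProduct (weight K ∘ b) (e [ i ]%= suc))
          ≈⟨ *-congˡ (rowProduct-inc (weight K ∘ b) e i (weight-suc (ab≈1 i) (lookup e i))) ⟩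
        factorial j * ((ι K - ι (lookup e i)) * rowProduct (weight K ∘ b) e)
          ≈⟨ solve 3 (λ f k r → f :* (k :* r) := f :* r :* k) refl _ _ _ ⟩
        (factorial j * rowProduct (weight K ∘ b) e) * (ι K - ι (lookup e i)) ∎

-- Determinants by expansion along rows, with columns indexed by lists

module Determinants {c ℓ} (F : Field c ℓ) where
  open FieldArithmetic F
  open LinearFunctionals F
  open IsLinear

  -- Alternating sum over the choice of one column, passed to `Ω` with the remaining columns in
  -- order. A general kernel `Ω` lets one recursion serve signed sums and determinants alike.
  laplace : (ℕ → List ℕ → Carrier) → List ℕ → Carrier
  laplace Ω []       = 0#
  laplace Ω (c ∷ cs) = Ω c cs - laplace (λ d ds → Ω d (c ∷ ds)) cs

  -- The recorded length and sum of the columns are what later restrict a signed sum to exponent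
  -- vectors of one total degree.
  laplace-cong : ∀ cs {Ω Ω′} →
                 (∀ d ds → suc (length ds) ≡ length cs → d ℕ.+ ListAction.sum ds ≡ ListAction.sum cs → Ω d ds ≈ Ω′ d ds) →
                 laplace Ω cs ≈ laplace Ω′ cs
  laplace-cong []       Ω≈Ω′ = refl
  laplace-cong (c ∷ cs) Ω≈Ω′ = +-cong (Ω≈Ω′ c cs ≡.refl ≡.refl) (-‿cong (laplace-cong cs λ d ds len Σ →
    Ω≈Ω′ d (c ∷ ds) (≡.cong suc len) (≡.trans (x∙yz≈y∙xz d c _) (≡.cong (c ℕ.+_) Σ))))
    where open import Algebra.Properties.CommutativeSemigroup ℕₚ.+-commutativeSemigroup using (x∙yz≈y∙xz)

  laplace-linear : ∀ {X : Set c} {T : (X → Carrier) → Carrier} → IsLinear T → ∀ (Ω : X → ℕ → List ℕ → Carrier) cs →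
                   T (λ x → laplace (Ω x) cs) ≈ laplace (λ d ds → T (λ x → Ω x d ds)) cs
  laplace-linear L Ω []       = T-0 L
  laplace-linear L Ω (c ∷ cs) = trans (T-sub L _ _) (+-congˡ (-‿cong (laplace-linear L (λ x d ds → Ω x d (c ∷ ds)) cs)))

  -- The sum of sgn(π) g(π(cs)) over the permutations π of the columns cs.
  alternatingSum : ∀ n → (Vec ℕ n → Carrier) → List ℕ → Carrier
  alternatingSum zero    g cs = g []
  alternatingSum (suc n) g    = laplace (λ d → alternatingSum n (λ e → g (d ∷ e)))

  alternatingSum-cong : ∀ n cs {g g′} → length cs ≡ n → (∀ e → Vec.sum e ≡ ListAction.sum cs → g e ≈ g′ e) →
                        alternatingSum n g cs ≈ alternatingSum n g′ cs
  alternatingSum-cong zero    [] _   g≈g′ = g≈g′ [] ≡.refl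
  alternatingSum-cong (suc n) cs len g≈g′ = laplace-cong cs λ d ds len′ Σ →
    alternatingSum-cong n ds (ℕₚ.suc-injective (≡.trans len′ len)) λ e Σe →
      g≈g′ (d ∷ e) (≡.trans (≡.cong (d ℕ.+_) Σe) Σ)

  alternatingSum-linear : ∀ {X : Set c} {T : (X → Carrier) → Carrier} → IsLinear T → ∀ n (g : X → Vec ℕ n → Carrier) cs →
                          T (λ x → alternatingSum n (g x) cs) ≈ alternatingSum n (λ e → T (λ x → g x e)) cs
  alternatingSum-linear L zero    g cs = refl
  alternatingSum-linear L (suc n) g cs = trans (laplace-linear L (λ x d → alternatingSum n (λ e → g x (d ∷ e))) cs)
    (laplace-cong cs λ d ds _ _ → alternatingSum-linear L n (λ x e → g x (d ∷ e)) ds)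

  -- Scaling is a linear functional on functions of one point, so moving a scalar into a signed sum
  -- is a case of moving a functional into it.
  scalar-linear : ∀ k → IsLinear {X = Lift c ⊤} (λ f → k * f _)
  scalar-linear k = record
    { T-cong = λ f≈g → *-congˡ (f≈g _)
    ; T-+    = λ _ _ → distribˡ _ _ _
    ; T-*    = λ _ _ → solve 3 (λ k l x → k :* (l :* x) := l :* (k :* x)) refl _ _ _
    }

  alternatingSum-* : ∀ n k (g : Vec ℕ n → Carrier) cs → k * alternatingSum n g cs ≈ alternatingSum n (λ e → k * g e) cs
  alternatingSum-* n k g = alternatingSum-linear (scalar-linear k) n (λ _ → g)

  infixr 6 _∧_
  -- The exterior product of a row with a form in the remaining columns.
  _∧_ : (ℕ → Carrier) → (List ℕ → Carrier) → List ℕ → Carrier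
  r ∧ ω = laplace (λ d ds → r d * ω ds)

  ∧-congˡ : ∀ {r r′} ω → (∀ d → r d ≈ r′ d) → ∀ cs → (r ∧ ω) cs ≈ (r′ ∧ ω) cs
  ∧-congˡ ω r≈r′ cs = laplace-cong cs λ d ds _ _ → *-congʳ (r≈r′ d)

  ∧-zeroʳ : ∀ r {ω} → (∀ cs → ω cs ≈ 0#) → ∀ cs → (r ∧ ω) cs ≈ 0#
  ∧-zeroʳ r ω≈0 []       = refl
  ∧-zeroʳ r ω≈0 (c ∷ cs) = trans (+-cong (trans (*-congˡ (ω≈0 cs)) (zeroʳ _)) (-‿cong (∧-zeroʳ r (ω≈0 ∘ (c ∷_)) cs))) (-‿inverseʳ 0#)

  ∧-*ˡ : ∀ k r ω cs → k * (r ∧ ω) cs ≈ ((λ d → k * r d) ∧ ω) cs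
  ∧-*ˡ k r ω cs = trans (laplace-linear (scalar-linear k) (λ _ d ds → r d * ω ds) cs)
    (laplace-cong cs λ d ds _ _ → sym (*-assoc _ _ _))

  -- The three terms are the cases where column `c` is taken by `r`, by `s`, or by `ω`.
  ∧∧-expand : ∀ r s ω c cs → (r ∧ s ∧ ω) (c ∷ cs) ≈
              r c * (s ∧ ω) cs - (s c * (r ∧ ω) cs - (r ∧ s ∧ (ω ∘ (c ∷_))) cs)
  ∧∧-expand r s ω c cs = +-congˡ (-‿cong (begin
    laplace (λ d ds → r d * (s c * ω ds - (s ∧ (ω ∘ (c ∷_))) ds)) cs
      ≈⟨ split r cs (s c) ω (s ∧ (ω ∘ (c ∷_))) ⟩
    s c * (r ∧ ω) cs - (r ∧ s ∧ (ω ∘ (c ∷_))) cs ∎))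
    where
    split : ∀ r cs k ω ω′ → (r ∧ (λ ds → k * ω ds - ω′ ds)) cs ≈ k * (r ∧ ω) cs - (r ∧ ω′) cs
    split r []       k ω ω′ = solve 1 (λ k → con (ℤ.+ 0) := k :* con (ℤ.+ 0) :- con (ℤ.+ 0)) refl k
    split r (c ∷ cs) k ω ω′ = trans (+-congˡ (-‿cong (split r cs k (ω ∘ (c ∷_)) (ω′ ∘ (c ∷_)))))
      (solve 6 (λ r k x y a b → r :* (k :* x :- y) :- (k :* a :- b) := k :* (r :* x :- a) :- (r :* y :- b))
        refl (r c) k (ω cs) (ω′ cs) _ _)

  ∧-anticomm : ∀ r s ω cs → (r ∧ s ∧ ω) cs ≈ - (s ∧ r ∧ ω) cs
  ∧-anticomm r s ω []       = sym -0#≈0#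
  ∧-anticomm r s ω (c ∷ cs) = begin
    (r ∧ s ∧ ω) (c ∷ cs)
      ≈⟨ ∧∧-expand r s ω c cs ⟩
    r c * (s ∧ ω) cs - (s c * (r ∧ ω) cs - (r ∧ s ∧ (ω ∘ (c ∷_))) cs)
      ≈⟨ +-congˡ (-‿cong (+-congˡ (-‿cong (∧-anticomm r s (ω ∘ (c ∷_)) cs)))) ⟩
    r c * (s ∧ ω) cs - (s c * (r ∧ ω) cs - - (s ∧ r ∧ (ω ∘ (c ∷_))) cs)
      ≈⟨ solve 3 (λ x y z → x :- (y :- (:- z)) := :- (y :- (x :- z))) refl _ _ _ ⟩
    - (s c * (r ∧ ω) cs - (r c * (s ∧ ω) cs - (s ∧ r ∧ (ω ∘ (c ∷_))) cs))
      ≈⟨ -‿cong (∧∧-expand s r ω c cs) ⟨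
    - (s ∧ r ∧ ω) (c ∷ cs) ∎

  Proportional : (r s : ℕ → Carrier) → Set ℓ
  Proportional r s = ∀ c d → r c * s d ≈ s c * r d

  -- Proved directly from the expansion: anticommutativity alone gives only x = -x, which says
  -- nothing in characteristic two.
  ∧-proportional : ∀ {r s} → Proportional r s → ∀ ω cs → (r ∧ s ∧ ω) cs ≈ 0#
  ∧-proportional         r∥s ω []       = refl
  ∧-proportional {r} {s} r∥s ω (c ∷ cs) = begin
    (r ∧ s ∧ ω) (c ∷ cs)
      ≈⟨ ∧∧-expand r s ω c cs ⟩
    r c * (s ∧ ω) cs - (s c * (r ∧ ω) cs - (r ∧ s ∧ (ω ∘ (c ∷_))) cs)
      ≈⟨ +-cong (trans (∧-*ˡ (r c) s ω cs) (trans (∧-congˡ ω (r∥s c) cs) (sym (∧-*ˡ (s c) r ω cs))))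
                (-‿cong (+-congˡ (-‿cong (∧-proportional r∥s (ω ∘ (c ∷_)) cs)))) ⟩
    s c * (r ∧ ω) cs - (s c * (r ∧ ω) cs - 0#)
      ≈⟨ solve 1 (λ x → x :- (x :- con (ℤ.+ 0)) := con (ℤ.+ 0)) refl _ ⟩
    0# ∎

  det : ∀ {n} → (Fin n → ℕ → Carrier) → List ℕ → Carrier
  det {zero}  R cs = 1#
  det {suc n} R    = R zero ∧ det (R ∘ suc)

  alternatingSum-rowProduct : ∀ {n} (R : Fin n → ℕ → Carrier) cs → alternatingSum n (rowProduct R) cs ≈ det R cs
  alternatingSum-rowProduct {zero}  R cs = refl
  alternatingSum-rowProduct {suc n} R cs = laplace-cong cs λ d ds _ _ → trans
    (sym (alternatingSum-* n (R zero d) (rowProduct (R ∘ suc)) ds))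
    (*-congˡ (alternatingSum-rowProduct (R ∘ suc) ds))

  ∧-det-proportional : ∀ {n r} (R : Fin n → ℕ → Carrier) i → Proportional r (R i) → ∀ cs → (r ∧ det R) cs ≈ 0#
  ∧-det-proportional         R zero    r∥Ri cs = ∧-proportional r∥Ri (det (R ∘ suc)) cs
  ∧-det-proportional {r = r} R (suc i) r∥Ri cs = begin
    (r ∧ R zero ∧ det (R ∘ suc)) cs      ≈⟨ ∧-anticomm r (R zero) (det (R ∘ suc)) cs ⟩
    - (R zero ∧ r ∧ det (R ∘ suc)) cs    ≈⟨ -‿cong (∧-zeroʳ (R zero) (∧-det-proportional (R ∘ suc) i r∥Ri) cs) ⟩
    - 0#                                 ≈⟨ -0#≈0# ⟩
    0#                                   ∎

  det-proportional : ∀ {n} (R : Fin n → ℕ → Carrier) {i j} → ¬ i ≡ j → Proportional (R i) (R j) → ∀ cs → det R cs ≈ 0#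
  det-proportional R {zero}  {zero}  i≢j _     = ⊥-elim (i≢j ≡.refl)
  det-proportional R {zero}  {suc j} i≢j Ri∥Rj = ∧-det-proportional (R ∘ suc) j Ri∥Rj
  det-proportional R {suc i} {zero}  i≢j Ri∥Rj = ∧-det-proportional (R ∘ suc) i λ c d → sym (Ri∥Rj c d)
  det-proportional R {suc i} {suc j} i≢j Ri∥Rj = ∧-zeroʳ (R zero) (det-proportional (R ∘ suc) (i≢j ∘ ≡.cong suc) Ri∥Rj)

-- The confluent Vandermonde determinant, by division of polynomials

module ConfluentVandermonde {c ℓ} (F : Field c ℓ) where
  open FieldArithmetic F
  open LinearFunctionals F
  open Determinants F
  open Multiplicities F

  -- Coefficient vectors list the highest degree first.
  ⟪_,_⟫ : ∀ {m} → (ℕ → Carrier) → Vec Carrier m → Carrier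
  ⟪ r , [] ⟫          = 0#
  ⟪ r , _∷_ {m} l f ⟫ = r m * l + ⟪ r , f ⟫

  ⟪⟫-cong : ∀ {m r s} → (∀ c → r c ≈ s c) → (f : Vec Carrier m) → ⟪ r , f ⟫ ≈ ⟪ s , f ⟫
  ⟪⟫-cong r≈s []      = refl
  ⟪⟫-cong r≈s (l ∷ f) = +-cong (*-congʳ (r≈s _)) (⟪⟫-cong r≈s f)

  ⟪⟫-* : ∀ {m} k r (f : Vec Carrier m) → ⟪ (λ c → k * r c) , f ⟫ ≈ k * ⟪ r , f ⟫
  ⟪⟫-* k r []      = sym (zeroʳ k)
  ⟪⟫-* k r (l ∷ f) = trans (+-cong (*-assoc _ _ _) (⟪⟫-* k r f)) (sym (distribˡ _ _ _))

  ⟪⟫-zero : ∀ {m r} → (∀ c → r c ≈ 0#) → (f : Vec Carrier m) → ⟪ r , f ⟫ ≈ 0#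
  ⟪⟫-zero r≈0 []      = refl
  ⟪⟫-zero r≈0 (l ∷ f) = trans (+-cong (trans (*-congʳ (r≈0 _)) (zeroˡ l)) (⟪⟫-zero r≈0 f)) (+-identityˡ 0#)

  ⟪⟫-neg : ∀ {m} r (f : Vec Carrier m) → ⟪ r , Vec.map -_ f ⟫ ≈ - ⟪ r , f ⟫
  ⟪⟫-neg r []      = sym -0#≈0#
  ⟪⟫-neg r (_∷_ {m} l f) = trans (+-congˡ (⟪⟫-neg r f))
    (solve 3 (λ a l y → a :* (:- l) :- y := :- (a :* l :+ y)) refl (r m) l ⟪ r , f ⟫)

  scale : ∀ {m} → (ℕ → Carrier) → Vec Carrier m → Vec Carrier m
  scale s []            = []
  scale s (_∷_ {m} l f) = s m * l ∷ scale s f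

  ⟪⟫-scale : ∀ {m} s r (f : Vec Carrier m) → ⟪ (λ c → s c * r c) , f ⟫ ≈ ⟪ r , scale s f ⟫
  ⟪⟫-scale s r []            = refl
  ⟪⟫-scale s r (_∷_ {m} l f) = +-cong (solve 3 (λ s r l → s :* r :* l := r :* (s :* l)) refl _ _ _) (⟪⟫-scale s r f)

  -- Signed minors as polynomial coefficients. In `ω ∘ (m ∷_)` the highest column has been passed
  -- over and stays in the minor.
  cofactors : (List ℕ → Carrier) → ∀ m → Vec Carrier m
  cofactors ω zero    = []
  cofactors ω (suc m) = ω (downFrom m) ∷ Vec.map -_ (cofactors (ω ∘ (m ∷_)) m)

  ∧-cofactors : ∀ r ω m → (r ∧ ω) (downFrom m) ≈ ⟪ r , cofactors ω m ⟫
  ∧-cofactors r ω zero    = refl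
  ∧-cofactors r ω (suc m) = +-congˡ (trans (-‿cong (∧-cofactors r (ω ∘ (m ∷_)) m)) (sym (⟪⟫-neg r (cofactors (ω ∘ (m ∷_)) m))))

  -- The adjoint of multiplication of polynomials by z − β.
  δ : Carrier → (ℕ → Carrier) → ℕ → Carrier
  δ β r c = r (suc c) - β * r c

  -- Horner's scheme: l ∷ f = (z - β)(l ∷ g) + ρ, tested against every functional `r`. The leading
  -- coefficient `l` is kept visible because division by a monic factor preserves it.
  divide : ∀ {m} β l (f : Vec Carrier (suc m)) →
           ∃₂ λ (g : Vec Carrier m) ρ → ∀ r → ⟪ r , l ∷ f ⟫ ≈ ⟪ δ β r , l ∷ g ⟫ + r 0 * ρ
  divide β l (l′ ∷ []) = [] , l′ + β * l , λ r →
    solve 5 (λ r₁ r₀ l l′ β → r₁ :* l :+ (r₀ :* l′ :+ con (ℤ.+ 0)) :=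
                              (r₁ :- β :* r₀) :* l :+ con (ℤ.+ 0) :+ r₀ :* (l′ :+ β :* l))
      refl (r 1) (r 0) l l′ β
  divide {suc m} β l (l′ ∷ f@(_ ∷ _)) with divide β (l′ + β * l) f
  ... | g , ρ , divides = l′ + β * l ∷ g , ρ , λ r → begin
    r (suc (suc m)) * l + (r (suc m) * l′ + ⟪ r , f ⟫)
      ≈⟨ solve 6 (λ r₁ r₀ l l′ β s → r₁ :* l :+ (r₀ :* l′ :+ s) := (r₁ :- β :* r₀) :* l :+ (r₀ :* (l′ :+ β :* l) :+ s))
           refl (r (suc (suc m))) (r (suc m)) l l′ β ⟪ r , f ⟫ ⟩
    δ β r (suc m) * l + ⟪ r , l′ + β * l ∷ f ⟫
      ≈⟨ +-congˡ (divides r) ⟩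
    δ β r (suc m) * l + (⟪ δ β r , l′ + β * l ∷ g ⟫ + r 0 * ρ)
      ≈⟨ +-assoc _ _ _ ⟨
    ⟪ δ β r , l ∷ l′ + β * l ∷ g ⟫ + r 0 * ρ ∎

  -- Pairing with the powers of `β` is evaluation at `β`, and `δ β` annihilates these powers, so the
  -- remainder is the value at the root.
  divide-root : ∀ {m} β l (f : Vec Carrier (suc m)) → ⟪ (β ^_) , l ∷ f ⟫ ≈ 0# →
                ∃ λ (g : Vec Carrier m) → ∀ r → ⟪ r , l ∷ f ⟫ ≈ ⟪ δ β r , l ∷ g ⟫
  divide-root β l f root with divide β l f
  ... | g , ρ , divides = g , λ r → trans (divides r) (trans (+-congˡ (trans (*-congˡ ρ≈0) (zeroʳ _))) (+-identityʳ _))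
    where
    ρ≈0 : ρ ≈ 0#
    ρ≈0 = begin
      ρ                                          ≈⟨ trans (+-identityˡ _) (*-identityˡ ρ) ⟨
      0# + 1# * ρ                                ≈⟨ +-congʳ (⟪⟫-zero (λ c → -‿inverseʳ _) (l ∷ g)) ⟨
      ⟪ δ β (β ^_) , l ∷ g ⟫ + 1# * ρ            ≈⟨ divides (β ^_) ⟨
      ⟪ (β ^_) , l ∷ f ⟫                         ≈⟨ root ⟩
      0#                                         ∎

  Δ : (ℕ → Carrier) → ℕ → Carrier
  Δ w c = w (suc c) - w c

  -- For p < char F, this says that w is a polynomial of degree p with leading coefficient κ / p!.
  ConstantΔ : ℕ → Carrier → (ℕ → Carrier) → Set ℓ
  ConstantΔ zero    κ w = ∀ c → w c ≈ κ
  ConstantΔ (suc p) κ w = ConstantΔ p κ (Δ w)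

  ConstantΔ-cong : ∀ p {κ w w′} → (∀ c → w c ≈ w′ c) → ConstantΔ p κ w → ConstantΔ p κ w′
  ConstantΔ-cong zero    w≈w′ const c = trans (sym (w≈w′ c)) (const c)
  ConstantΔ-cong (suc p) w≈w′ const   = ConstantΔ-cong p (λ c → +-cong (w≈w′ (suc c)) (-‿cong (w≈w′ c))) const

  ConstantΔ-* : ∀ p k {κ w} → ConstantΔ p κ w → ConstantΔ p (k * κ) (λ c → k * w c)
  ConstantΔ-* zero    k const c = *-congˡ (const c)
  ConstantΔ-* (suc p) k {w = w} const = ConstantΔ-cong p
    (λ c → solve 3 (λ k x y → k :* (x :- y) := k :* x :- k :* y) refl k (w (suc c)) (w c)) (ConstantΔ-* p k const)

  ConstantΔ-+ : ∀ p {κ κ′ w w′} → ConstantΔ p κ w → ConstantΔ p κ′ w′ → ConstantΔ p (κ + κ′) (λ c → w c + w′ c)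
  ConstantΔ-+ zero    const const′ c = +-cong (const c) (const′ c)
  ConstantΔ-+ (suc p) {w = w} {w′} const const′ = ConstantΔ-cong p
    (λ c → solve 4 (λ a b c d → (a :- b) :+ (c :- d) := (a :+ c) :- (b :+ d)) refl (w (suc c)) (w c) (w′ (suc c)) (w′ c))
    (ConstantΔ-+ p const const′)

  ConstantΔ-Δ : ∀ p {κ w} → ConstantΔ p κ w → ConstantΔ p 0# (Δ w)
  ConstantΔ-Δ zero    const c = x≈y⇒x-y≈0 (trans (const (suc c)) (sym (const c)))
  ConstantΔ-Δ (suc p) const   = ConstantΔ-Δ p const

  -- Sequences annihilated by (E - β)^(p+1), E being the shift; for β ≠ 0, the condition κ ≠ 0
  -- ensures that no smaller power suffices.
  Geometric : ℕ → Carrier → (ℕ → Carrier) → Set (c ⊔ ℓ)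
  Geometric p β r = ∃₂ λ w κ → ¬ κ ≈ 0# × ConstantΔ p κ w × (∀ c → r c ≈ w c * β ^ c)

  δ-Geometric-≈ : ∀ {p β γ r} → ¬ γ ≈ 0# → β ≈ γ → Geometric (suc p) γ r → Geometric p γ (δ β r)
  δ-Geometric-≈ {p} {β} {γ} {r} γ≉0 β≈γ (w , κ , κ≉0 , const , r≈) =
    (λ c → γ * Δ w c) , γ * κ , *-≉0 γ≉0 κ≉0 , ConstantΔ-* p γ const , λ c → begin
      r (suc c) - β * r c                             ≈⟨ +-cong (r≈ (suc c)) (-‿cong (*-cong β≈γ (r≈ c))) ⟩
      w (suc c) * (γ * γ ^ c) - γ * (w c * γ ^ c)     ≈⟨ solve 4 (λ x y g p → x :* (g :* p) :- g :* (y :* p) := g :* (x :- y) :* p)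
                                                           refl (w (suc c)) (w c) γ (γ ^ c) ⟩
      γ * Δ w c * γ ^ c                               ∎

  δ-Geometric-≉ : ∀ {p β γ r} → ¬ γ ≈ β → Geometric p γ r → Geometric p γ (δ β r)
  δ-Geometric-≉ {p} {β} {γ} {r} γ≉β (w , κ , κ≉0 , const , r≈) =
    -- The summand `γ * Δ w c` has lower degree: its p-th difference is 0, so only (γ - β)κ
    -- survives.
    (λ c → (γ - β) * w c + γ * Δ w c) , (γ - β) * κ + γ * 0# ,
    ≉0-≈ (sym (trans (+-congˡ (zeroʳ γ)) (+-identityʳ _))) (*-≉0 (difference-≉0 γ≉β) κ≉0) ,
    ConstantΔ-+ p (ConstantΔ-* p (γ - β) const) (ConstantΔ-* p γ (ConstantΔ-Δ p const)) , λ c → begin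
      r (suc c) - β * r c                             ≈⟨ +-cong (r≈ (suc c)) (-‿cong (*-congˡ (r≈ c))) ⟩
      w (suc c) * (γ * γ ^ c) - β * (w c * γ ^ c)     ≈⟨ solve 5 (λ x y g b p → x :* (g :* p) :- b :* (y :* p) := ((g :- b) :* y :+ g :* (x :- y)) :* p)
                                                           refl (w (suc c)) (w c) γ β (γ ^ c) ⟩
      ((γ - β) * w c + γ * Δ w c) * γ ^ c             ∎

  δs : ∀ {k} → (Fin k → Carrier) → (ℕ → Carrier) → ℕ → Carrier
  δs {zero}  β r = r
  δs {suc k} β r = δ (β zero) (δs (β ∘ suc) r)

  -- Each factor z − 1/aᵢ with aᵢ = v lowers the degree of the polynomial part by one; the others preserve it.
  δs-Geometric : ∀ {k} (a : Fin k → Carrier) → (∀ i → ¬ a i ≈ 0#) → ∀ {v} → ¬ v ≈ 0# → ∀ {s r} →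
                 Geometric (mult a v ℕ.+ s) (inv v) r → Geometric s (inv v) (δs (inv ∘ a) r)
  δs-Geometric {zero}  a a≉0 v≉0 geo = geo
  δs-Geometric {suc k} a a≉0 {v} v≉0 {s} {r} geo with a zero ≟ v
  ... | yes a₀≈v = δ-Geometric-≈ {p = s} (inv-≉0 v≉0) (inv-cong (a≉0 zero) v≉0 a₀≈v)
    (δs-Geometric (a ∘ suc) (a≉0 ∘ suc) v≉0
      (≡.subst (λ p → Geometric p (inv v) r) (≡.sym (ℕₚ.+-suc (mult (a ∘ suc) v) s)) geo))
  ... | no  a₀≉v = δ-Geometric-≉ {p = s} (λ eq → a₀≉v (sym (inv-injective v≉0 (a≉0 zero) eq)))
    (δs-Geometric (a ∘ suc) (a≉0 ∘ suc) v≉0 geo)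

  falling-cong : ∀ p {x y} → x ≈ y → falling x p ≈ falling y p
  falling-cong zero    x≈y = refl
  falling-cong (suc p) x≈y = *-cong (+-congʳ x≈y) (falling-cong p x≈y)

  falling-suc : ∀ x p → falling x (suc p) ≈ x * falling (x - 1#) p
  falling-suc x zero    = *-congʳ (trans (+-congˡ -0#≈0#) (+-identityʳ x))
  falling-suc x (suc p) = trans (*-congˡ (falling-suc x p))
    (solve 4 (λ o x i f → (x :- (o :+ i)) :* (x :* f) := x :* ((x :- o :- i) :* f)) refl 1# x (ι p) (falling (x - 1#) p))

  falling-+ : ∀ x p c → falling x (p ℕ.+ c) ≈ falling x c * falling (x - ι c) p
  falling-+ x zero    c = sym (*-identityʳ _)
  falling-+ x (suc p) c = begin
    (x - ι (p ℕ.+ c)) * falling x (p ℕ.+ c)                   ≈⟨ *-cong (+-congˡ (-‿cong (ι-+ p c))) (falling-+ x p c) ⟩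
    (x - (ι p + ι c)) * (falling x c * falling (x - ι c) p)   ≈⟨ solve 5 (λ x p c f g → (x :- (p :+ c)) :* (f :* g) := f :* ((x :- c :- p) :* g))
                                                                   refl x (ι p) (ι c) (falling x c) (falling (x - ι c) p) ⟩
    falling x c * falling (x - ι c) (suc p)                   ∎

  -- Each difference in `c` lowers the order by one and produces the factor -p, -(p-1), ...,
  -- collected in `k`; the final constant is k(-1)^p p!.
  falling-ConstantΔ : ∀ p → (∀ m → 1 ℕ.≤ m → m ℕ.≤ p → ¬ ι m ≈ 0#) → ∀ {k} x → ¬ k ≈ 0# →
                      ∃ λ κ → ¬ κ ≈ 0# × ConstantΔ p κ (λ c → k * falling (x - ι c) p)
  falling-ConstantΔ zero    ι≉0 {k} x k≉0 = k * 1# , *-≉0 k≉0 1≉0 , λ _ → refl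
  falling-ConstantΔ (suc p) ι≉0 {k} x k≉0
    with falling-ConstantΔ p (λ m 1≤m m≤p → ι≉0 m 1≤m (ℕₚ.m≤n⇒m≤1+n m≤p)) (x - 1#)
           (*-≉0 k≉0 (λ -i≈0 → ι≉0 (suc p) (s≤s z≤n) ℕₚ.≤-refl (trans (sym (-‿involutive _)) (trans (-‿cong -i≈0) -0#≈0#))))
  ... | κ , κ≉0 , const = κ , κ≉0 , ConstantΔ-cong p (λ c → sym (step c)) const
    where
    step : ∀ c → k * falling (x - ι (suc c)) (suc p) - k * falling (x - ι c) (suc p) ≈
                 k * - ι (suc p) * falling (x - 1# - ι c) p
    step c = begin
      k * falling (x - ι (suc c)) (suc p) - k * falling (x - ι c) (suc p)
        ≈⟨ +-cong (*-congˡ (falling-cong (suc p) (solve 3 (λ o x i → x :- (o :+ i) := x :- o :- i) refl 1# x (ι c))))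
                  (-‿cong (*-congˡ (trans (falling-suc (x - ι c) p)
                    (*-congˡ (falling-cong p (solve 3 (λ o x i → x :- i :- o := x :- o :- i) refl 1# x (ι c))))))) ⟩
      k * ((x - 1# - ι c - ι p) * falling (x - 1# - ι c) p) - k * ((x - ι c) * falling (x - 1# - ι c) p)
        ≈⟨ solve 6 (λ o k x c p f → k :* ((x :- o :- c :- p) :* f) :- k :* ((x :- c) :* f) := k :* (:- (o :+ p)) :* f)
             refl 1# k x (ι c) (ι p) (falling (x - 1# - ι c) p) ⟩
      k * - ι (suc p) * falling (x - 1# - ι c) p ∎

  ^-≉0 : ∀ {x} → ¬ x ≈ 0# → ∀ n → ¬ x ^ n ≈ 0#
  ^-≉0 x≉0 zero    = 1≉0
  ^-≉0 x≉0 (suc n) = *-≉0 x≉0 (^-≉0 x≉0 n)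

  module _ (K : ℕ) where

    confluentRow : Carrier → ℕ → ℕ → Carrier
    confluentRow β p c = falling (ι K - ι c) p * β ^ c

    -- Separates a factor of the row alone, `β ^ p`, and a factor of the column alone,
    -- `falling (ι K) c`; what is left is a polynomial in `c` times `β ^ c`.
    weight-confluentRow : ∀ β p c → weight K β (p ℕ.+ c) ≈ β ^ p * (falling (ι K) c * confluentRow β p c)
    weight-confluentRow β p c = trans (*-cong (falling-+ (ι K) p c) (^-homo-* β p c))
      (solve 4 (λ f g x y → (f :* g) :* (x :* y) := x :* (f :* (g :* y))) refl _ _ _ _)

    confluentRows : ∀ {n} → (Fin n → Carrier) → Fin n → ℕ → Carrier
    confluentRows a i c = weight K (inv (a i)) (laterOccurrences a i ℕ.+ c)

    columnCofactors : (List ℕ → Carrier) → ∀ m → Vec Carrier m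
    columnCofactors ω m = scale (falling (ι K)) (cofactors ω m)

    ∧-columnCofactors : ∀ β p ω m → ((λ c → weight K β (p ℕ.+ c)) ∧ ω) (downFrom m) ≈
                        β ^ p * ⟪ confluentRow β p , columnCofactors ω m ⟫
    ∧-columnCofactors β p ω m = begin
      ((λ c → weight K β (p ℕ.+ c)) ∧ ω) (downFrom m)
        ≈⟨ ∧-cofactors (λ c → weight K β (p ℕ.+ c)) ω m ⟩
      ⟪ (λ c → weight K β (p ℕ.+ c)) , cofactors ω m ⟫
        ≈⟨ ⟪⟫-cong (weight-confluentRow β p) (cofactors ω m) ⟩
      ⟪ (λ c → β ^ p * (falling (ι K) c * confluentRow β p c)) , cofactors ω m ⟫
        ≈⟨ ⟪⟫-* (β ^ p) (λ c → falling (ι K) c * confluentRow β p c) (cofactors ω m) ⟩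
      β ^ p * ⟪ (λ c → falling (ι K) c * confluentRow β p c) , cofactors ω m ⟫
        ≈⟨ *-congˡ (⟪⟫-scale (falling (ι K)) (confluentRow β p) (cofactors ω m)) ⟩
      β ^ p * ⟪ confluentRow β p , columnCofactors ω m ⟫ ∎

    -- Pairing the cofactors with a row already present gives a determinant with a repeated row.
    columnCofactors-killed : ∀ {k} (a : Fin k → Carrier) → (∀ i → ¬ a i ≈ 0#) → ∀ m i →
      ⟪ confluentRow (inv (a i)) (laterOccurrences a i) , columnCofactors (det (confluentRows a)) m ⟫ ≈ 0#
    columnCofactors-killed a a≉0 m i = *-cancel-0 (^-≉0 (inv-≉0 (a≉0 i)) (laterOccurrences a i))
      (trans (sym (∧-columnCofactors (inv (a i)) (laterOccurrences a i) (det (confluentRows a)) m))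
             (∧-det-proportional (confluentRows a) i (λ _ _ → refl) (downFrom m)))

    module _ (ι≉0 : ∀ m → 1 ℕ.≤ m → m ℕ.≤ K → ¬ ι m ≈ 0#) where

      falling-≉0 : ∀ {e} → e ℕ.≤ K → ¬ falling (ι K) e ≈ 0#
      falling-≉0 {zero}  _   = 1≉0
      falling-≉0 {suc e} e<K = *-≉0 (≉0-≈ (sym K-e) (ι≉0 (K ℕ.∸ e) (ℕₚ.m<n⇒0<n∸m e<K) (ℕₚ.m∸n≤m K e)))
                                    (falling-≉0 (ℕₚ.<⇒≤ e<K))
        where
        K-e : ι K - ι e ≈ ι (K ℕ.∸ e)
        K-e = begin
          ι K - ι e                       ≡⟨ ≡.cong (λ k → ι k - ι e) (ℕₚ.m∸n+n≡m (ℕₚ.<⇒≤ e<K)) ⟨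
          ι (K ℕ.∸ e ℕ.+ e) - ι e         ≈⟨ +-congʳ (ι-+ (K ℕ.∸ e) e) ⟩
          ι (K ℕ.∸ e) + ι e - ι e         ≈⟨ solve 2 (λ x y → x :+ y :- y := x) refl (ι (K ℕ.∸ e)) (ι e) ⟩
          ι (K ℕ.∸ e)                     ∎

      -- The polynomial part has degree `mult a v`, and exactly that many of the factors z - 1/aᵢ
      -- match `v`, so only a nonzero constant times a geometric sequence is left.
      δs-confluentRow : ∀ {k} (a : Fin k → Carrier) → (∀ i → ¬ a i ≈ 0#) → ∀ {v} → ¬ v ≈ 0# → k ℕ.≤ K →
                        ∃ λ κ → ¬ κ ≈ 0# × (∀ c → δs (inv ∘ a) (confluentRow (inv v) (mult a v)) c ≈ κ * inv v ^ c)
      δs-confluentRow a a≉0 {v} v≉0 k≤K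
        with falling-ConstantΔ (mult a v) (λ m 1≤m m≤p → ι≉0 m 1≤m (ℕₚ.≤-trans m≤p (ℕₚ.≤-trans (count≤n _) k≤K))) (ι K) 1≉0
      ... | κ , κ≉0 , const
        with δs-Geometric a a≉0 v≉0 {s = 0} {r = confluentRow (inv v) (mult a v)}
               (≡.subst (λ p → Geometric p (inv v) (confluentRow (inv v) (mult a v))) (≡.sym (ℕₚ.+-identityʳ (mult a v)))
                 ((λ c → 1# * falling (ι K - ι c) (mult a v)) , κ , κ≉0 , const , λ c → *-congʳ (sym (*-identityˡ _))))
      ...   | w , κ′ , κ′≉0 , const′ , geo = κ′ , κ′≉0 , λ c → trans (geo c) (*-congʳ (const′ c))

      -- The later factors are divided out first. They reduce row 0, whose order counts the later
      -- equal values, to a nonzero multiple of the powers of 1/a₀; hence 1/a₀ is a root of the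
      -- remaining quotient, repeated values included.
      factor : ∀ {k} (a : Fin k → Carrier) → (∀ i → ¬ a i ≈ 0#) → k ℕ.≤ K →
               ∀ {L m} → L ≡ k ℕ.+ m → ∀ l (f : Vec Carrier L) →
               (∀ i → ⟪ confluentRow (inv (a i)) (laterOccurrences a i) , l ∷ f ⟫ ≈ 0#) →
               ∃ λ (g : Vec Carrier m) → ∀ r → ⟪ r , l ∷ f ⟫ ≈ ⟪ δs (inv ∘ a) r , l ∷ g ⟫
      factor {zero}  a a≉0 k≤K ≡.refl l f _ = f , λ r → refl
      factor {suc k} a a≉0 k<K {m = m} L≡ l f killed =
        proj₁ quotient , λ r → trans (proj₂ tail r) (proj₂ quotient (δs (inv ∘ a ∘ suc) r))
        where
        β = inv (a zero)
        row : ℕ → Carrier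
        row = confluentRow β (laterOccurrences a zero)
        tail : ∃ λ (g : Vec Carrier (suc m)) → ∀ r → ⟪ r , l ∷ f ⟫ ≈ ⟪ δs (inv ∘ a ∘ suc) r , l ∷ g ⟫
        tail = factor (a ∘ suc) (a≉0 ∘ suc) (ℕₚ.<⇒≤ k<K) (≡.trans L≡ (≡.sym (ℕₚ.+-suc k m))) l f (killed ∘ suc)
        g = proj₁ tail
        residual : ∃ λ κ → ¬ κ ≈ 0# × (∀ c → δs (inv ∘ a ∘ suc) row c ≈ κ * β ^ c)
        residual = δs-confluentRow (a ∘ suc) (a≉0 ∘ suc) (a≉0 zero) (ℕₚ.<⇒≤ k<K)
        κ = proj₁ residual
        root : ⟪ (β ^_) , l ∷ g ⟫ ≈ 0#
        root = *-cancel-0 (proj₁ (proj₂ residual)) (begin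
          κ * ⟪ (β ^_) , l ∷ g ⟫                      ≈⟨ ⟪⟫-* κ (β ^_) (l ∷ g) ⟨
          ⟪ (λ c → κ * β ^ c) , l ∷ g ⟫               ≈⟨ ⟪⟫-cong (proj₂ (proj₂ residual)) (l ∷ g) ⟨
          ⟪ δs (inv ∘ a ∘ suc) row , l ∷ g ⟫          ≈⟨ proj₂ tail row ⟨
          ⟪ row , l ∷ f ⟫                             ≈⟨ killed zero ⟩
          0#                                          ∎)
        quotient : ∃ λ (h : Vec Carrier m) → ∀ r → ⟪ r , l ∷ g ⟫ ≈ ⟪ δ β r , l ∷ h ⟫
        quotient = divide-root β l g root

      -- After all `k` divisions only the leading coefficient remains, and the reduced row
      -- multiplies it by a nonzero constant.
      confluentRow-≉0 : ∀ {k} (a : Fin k → Carrier) → (∀ i → ¬ a i ≈ 0#) → ∀ {v} → ¬ v ≈ 0# → k ℕ.≤ K →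
                        ∀ l (f : Vec Carrier k) → ¬ l ≈ 0# →
                        (∀ i → ⟪ confluentRow (inv (a i)) (laterOccurrences a i) , l ∷ f ⟫ ≈ 0#) →
                        ¬ ⟪ confluentRow (inv v) (mult a v) , l ∷ f ⟫ ≈ 0#
      confluentRow-≉0 {k} a a≉0 {v} v≉0 k≤K l f l≉0 killed row≈0
        with factor a a≉0 k≤K (≡.sym (ℕₚ.+-identityʳ k)) l f killed | δs-confluentRow a a≉0 v≉0 k≤K
      ... | [] , factors | κ , κ≉0 , residue = *-≉0 (*-≉0 κ≉0 1≉0) l≉0 (begin
        κ * 1# * l                                              ≈⟨ +-identityʳ _ ⟨
        κ * 1# * l + 0#                                         ≈⟨ +-congʳ (*-congʳ (residue 0)) ⟨
        ⟪ δs (inv ∘ a) row , l ∷ [] ⟫                           ≈⟨ factors row ⟨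
        ⟪ row , l ∷ f ⟫                                         ≈⟨ row≈0 ⟩
        0#                                                      ∎)
        where
        row : ℕ → Carrier
        row = confluentRow (inv v) (mult a v)

      -- The cofactors of the first row form a polynomial of exact degree n − 1 that the other rows annihilate.
      -- It is therefore a multiple of the product of z − 1/aᵢ over i > 0, on which the first row cannot vanish.
      det-confluent-≉0 : ∀ {n} (a : Fin n → Carrier) → (∀ i → ¬ a i ≈ 0#) → n ℕ.≤ suc K →
                         ¬ det (confluentRows a) (downFrom n) ≈ 0#
      det-confluent-≉0 {zero}  a a≉0 _ = 1≉0
      det-confluent-≉0 {suc k} a a≉0 (s≤s k≤K) det≈0 =
        confluentRow-≉0 (a ∘ suc) (a≉0 ∘ suc) (a≉0 zero) k≤K
          (falling (ι K) k * ω (downFrom k)) (scale (falling (ι K)) (Vec.map -_ (cofactors (ω ∘ (k ∷_)) k)))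
          (*-≉0 (falling-≉0 k≤K) (det-confluent-≉0 (a ∘ suc) (a≉0 ∘ suc) (ℕₚ.m≤n⇒m≤1+n k≤K)))
          (columnCofactors-killed (a ∘ suc) (a≉0 ∘ suc) (suc k))
          (*-cancel-0 (^-≉0 (inv-≉0 (a≉0 zero)) (laterOccurrences a zero))
            (trans (sym (∧-columnCofactors (inv (a zero)) (laterOccurrences a zero) ω (suc k))) det≈0))
        where
        ω : List ℕ → Carrier
        ω = det (confluentRows (a ∘ suc))

-- Assembly: avoiding known sums and the nonvanishing top moment

module RestrictedSumset {c ℓ} (F : Field c ℓ) where
  open FieldArithmetic F
  open LinearFunctionals F
  open Determinants F
  open Multiplicities F
  open ConfluentVandermonde F
  open IsLinear
  open Membership setoid using (_∈_)

  shift : ∀ {n} → (Fin n → ℕ) → Vec ℕ n → Vec ℕ n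
  shift p []       = []
  shift p (e ∷ es) = p zero ℕ.+ e ∷ shift (p ∘ suc) es

  rowProduct-shift : ∀ {n} (R : Fin n → ℕ → Carrier) p e →
                     rowProduct (λ i c → R i (p i ℕ.+ c)) e ≡ rowProduct R (shift p e)
  rowProduct-shift R p []       = ≡.refl
  rowProduct-shift R p (e ∷ es) = ≡.cong (R zero (p zero ℕ.+ e) *_) (rowProduct-shift (R ∘ suc) (p ∘ suc) es)

  sum-shift : ∀ {n} (p : Fin n → ℕ) e → Vec.sum (shift p e) ≡ sumℕ p ℕ.+ Vec.sum e
  sum-shift p []       = ≡.refl
  sum-shift p (e ∷ es) = ≡.trans (≡.cong (p zero ℕ.+ e ℕ.+_) (sum-shift (p ∘ suc) es))
    (solve′ 4 (λ p e q s → p :+′ e :+′ (q :+′ s) :=′ p :+′ q :+′ (e :+′ s)) ≡.refl (p zero) e (sumℕ (p ∘ suc)) (Vec.sum es))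
    where open +-*-Solver using () renaming (solve to solve′; _:+_ to _:+′_; _:=_ to _:=′_)

  avoid : ∀ {m} → (Fin m → Carrier) → Carrier → Carrier
  avoid {zero}  s z = 1#
  avoid {suc m} s z = (z - s zero) * avoid (s ∘ suc) z

  avoid-≉0 : ∀ {m} (s : Fin m → Carrier) {z} → ¬ avoid s z ≈ 0# → ∀ i → ¬ z ≈ s i
  avoid-≉0 s av≉0 zero    z≈s = av≉0 (trans (*-congʳ (x≈y⇒x-y≈0 z≈s)) (zeroˡ _))
  avoid-≉0 s av≉0 (suc i) = avoid-≉0 (s ∘ suc) (λ av≈0 → av≉0 (trans (*-congˡ av≈0) (zeroʳ _))) i

  module _ {X : Set c} {T : (X → Carrier) → Carrier} (L : IsLinear T) (h u : X → Carrier) (d : ℕ)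
           (low : ∀ j → j ℕ.< d → T (λ x → h x ^ j * u x) ≈ 0#) where

    -- Trades the factor h - s₀ for one more power of h, up to a term of lower total degree in h;
    -- repeating this replaces expanding the product.
    avoid-suc : ∀ {m} (s : Fin (suc m) → Carrier) j →
                T (λ x → h x ^ j * (avoid s (h x) * u x)) ≈
                T (λ x → h x ^ suc j * (avoid (s ∘ suc) (h x) * u x)) -
                s zero * T (λ x → h x ^ j * (avoid (s ∘ suc) (h x) * u x))
    avoid-suc s j = trans
      (T-cong L λ x → solve 5 (λ p h s a u → p :* ((h :- s) :* a :* u) := h :* p :* (a :* u) :- s :* (p :* (a :* u)))
        refl (h x ^ j) (h x) (s zero) (avoid (s ∘ suc) (h x)) (u x))
      (trans (T-sub L (λ x → h x ^ suc j * (avoid (s ∘ suc) (h x) * u x)) (λ x → s zero * (h x ^ j * (avoid (s ∘ suc) (h x) * u x))))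
             (+-congˡ (-‿cong (T-* L (s zero) (λ x → h x ^ j * (avoid (s ∘ suc) (h x) * u x))))))

    avoid-low : ∀ {m} (s : Fin m → Carrier) j → m ℕ.+ j ℕ.< d → T (λ x → h x ^ j * (avoid s (h x) * u x)) ≈ 0#
    avoid-low {zero}  s j j<d = trans (T-cong L λ x → *-congˡ (*-identityˡ _)) (low j j<d)
    avoid-low {suc m} s j m+j<d = trans (avoid-suc s j) (x≈y⇒x-y≈0
      (trans (avoid-low (s ∘ suc) (suc j) (≡.subst (ℕ._< d) (≡.sym (ℕₚ.+-suc m j)) m+j<d))
             (sym (trans (*-congˡ (avoid-low (s ∘ suc) j (ℕₚ.<-trans (ℕₚ.n<1+n _) m+j<d))) (zeroʳ _)))))

    avoid-top : ∀ {m} (s : Fin m → Carrier) j → m ℕ.+ j ≡ d →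
                T (λ x → h x ^ j * (avoid s (h x) * u x)) ≈ T (λ x → h x ^ d * u x)
    avoid-top {zero}  s j ≡.refl = T-cong L λ x → *-congˡ (*-identityˡ _)
    avoid-top {suc m} s j m+j≡d = begin
      T (λ x → h x ^ j * (avoid s (h x) * u x))
        ≈⟨ avoid-suc s j ⟩
      T (λ x → h x ^ suc j * (avoid (s ∘ suc) (h x) * u x)) - s zero * T (λ x → h x ^ j * (avoid (s ∘ suc) (h x) * u x))
        ≈⟨ +-cong (avoid-top (s ∘ suc) (suc j) (≡.trans (ℕₚ.+-suc m j) m+j≡d))
                  (-‿cong (trans (*-congˡ (avoid-low (s ∘ suc) j (ℕₚ.≤-reflexive m+j≡d))) (zeroʳ _))) ⟩
      T (λ x → h x ^ d * u x) - 0#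
        ≈⟨ trans (+-congˡ -0#≈0#) (+-identityʳ _) ⟩
      T (λ x → h x ^ d * u x) ∎

  -- The sums are given by a predicate rather than a list, so the bound is reached by producing new
  -- ones instead of by contradiction with a full enumeration.
  AtLeast-greedy : ∀ {P : Carrier → Set (c ⊔ ℓ)} M →
                   (∀ {m} (s : Fin m → Carrier) → m ℕ.< M → ∃ λ z → P z × (∀ i → ¬ z ≈ s i)) → AtLeast M P
  AtLeast-greedy {P} M extend = go M ℕₚ.≤-refl
    where
    go : ∀ m → m ℕ.≤ M → AtLeast m P
    go zero    _   = (λ ()) , (λ ()) , (λ ())
    go (suc m) m<M with go m (ℕₚ.<⇒≤ m<M)
    ... | s , s-injective , Ps with extend s m<M
    ...   | z , Pz , z∉s = s′ , s′-injective , λ { zero → Pz ; (suc i) → Ps i }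
      where
      s′ : Fin (suc m) → Carrier
      s′ zero    = z
      s′ (suc i) = s i
      s′-injective : ∀ k l → s′ k ≈ s′ l → k ≡ l
      s′-injective zero    zero    _   = ≡.refl
      s′-injective zero    (suc l) z≈s = ⊥-elim (z∉s l z≈s)
      s′-injective (suc k) zero    s≈z = ⊥-elim (z∉s k (sym s≈z))
      s′-injective (suc k) (suc l) s≈s = ≡.cong suc (s-injective k l s≈s)

  lookup-injective : ∀ A → Unique setoid A → ∀ i j → List.lookup A i ≈ List.lookup A j → i ≡ j
  lookup-injective (x ∷ A) unique       zero    zero    _  = ≡.refl
  lookup-injective (x ∷ A) unique       zero    (suc j) eq =
    ⊥-elim (Unique[x∷xs]⇒x∉xs setoid unique (∈-resp-≈ setoid (sym eq) (∈-lookup setoid A j)))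
  lookup-injective (x ∷ A) unique       (suc i) zero    eq =
    ⊥-elim (Unique[x∷xs]⇒x∉xs setoid unique (∈-resp-≈ setoid eq (∈-lookup setoid A i)))
  lookup-injective (x ∷ A) (_ ∷ unique) (suc i) (suc j) eq = ≡.cong suc (lookup-injective A unique i j eq)

  restrictedSum-nonempty : ∀ A → Unique setoid A → ∀ {n} (a : Fin n → Carrier) → n ℕ.≤ length A →
                           AtLeast 1 (InRestrictedSum A a)
  restrictedSum-nonempty A unique {n} a n≤A =
    (λ _ → sum (λ i → a i * x i)) , (λ { zero zero _ → ≡.refl }) ,
    λ _ → x , (λ i → ∈-lookup setoid A (Fin.inject≤ i n≤A)) ,
          (λ i j xi≈xj → Finₚ.inject≤-injective n≤A n≤A i j (lookup-injective A unique _ _ xi≈xj)) , refl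
    where
    x : Fin n → Carrier
    x i = List.lookup A (Fin.inject≤ i n≤A)

  ι≉0-below-characteristic : ∀ {p d} → IsCharacteristic p → p ≡ 0 ⊎ d ℕ.< p → ∀ m → 1 ℕ.≤ m → m ℕ.≤ d → ¬ ι m ≈ 0#
  ι≉0-below-characteristic (inj₁ (_ , nonzero))     _             m 1≤m _   = nonzero m 1≤m
  ι≉0-below-characteristic (inj₂ (1≤p , _ , _))     (inj₁ ≡.refl) m _   _   = ⊥-elim (ℕₚ.n≮0 1≤p)
  ι≉0-below-characteristic (inj₂ (_ , _ , nonzero)) (inj₂ d<p)    m 1≤m m≤d = nonzero m 1≤m (ℕₚ.≤-<-trans m≤d d<p)

  factorial-≉0 : ∀ d → (∀ m → 1 ℕ.≤ m → m ℕ.≤ d → ¬ ι m ≈ 0#) → ¬ factorial d ≈ 0#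
  factorial-≉0 zero    ι≉0 = 1≉0
  factorial-≉0 (suc d) ι≉0 = *-≉0 (ι≉0 (suc d) (s≤s z≤n) ℕₚ.≤-refl)
    (factorial-≉0 d λ m 1≤m m≤d → ι≉0 m 1≤m (ℕₚ.m≤n⇒m≤1+n m≤d))

  alternatingSum-zero : ∀ n cs → alternatingSum n (λ _ → 0#) cs ≈ 0#
  alternatingSum-zero n cs = sym (alternatingSum-linear {X = Carrier} {T = λ _ → 0#}
    (record { T-cong = λ _ → refl ; T-+ = λ _ _ → sym (+-identityˡ 0#) ; T-* = λ k _ → sym (zeroʳ k) })
    n (λ _ _ → 0#) cs)

  powerRows : ∀ {n} → (Fin n → ℕ) → Vec Carrier n → Fin n → ℕ → Carrier
  powerRows p xs i c = lookup xs i ^ (p i ℕ.+ c)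

  -- For equal points the rows differ by the factors x^pᵢ and x^pⱼ. Cross-multiplied proportionality
  -- covers x = 0 without a case distinction.
  powerRows-proportional : ∀ {n} (p : Fin n → ℕ) xs {i j} → lookup xs i ≈ lookup xs j →
                           Proportional (powerRows p xs i) (powerRows p xs j)
  powerRows-proportional p xs {i} {j} x≈y c d = begin
    x ^ (p i ℕ.+ c) * y ^ (p j ℕ.+ d)               ≈⟨ *-cong (^-homo-* x (p i) c) (^-homo-* y (p j) d) ⟩
    (x ^ p i * x ^ c) * (y ^ p j * y ^ d)           ≈⟨ *-cong (*-congˡ (^-congˡ c x≈y)) (*-congˡ (^-congˡ d (sym x≈y))) ⟩
    (x ^ p i * y ^ c) * (y ^ p j * x ^ d)           ≈⟨ solve 4 (λ a b c d → (a :* b) :* (c :* d) := (c :* b) :* (a :* d)) refl _ _ _ _ ⟩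
    (y ^ p j * y ^ c) * (x ^ p i * x ^ d)           ≈⟨ *-cong (^-homo-* y (p j) c) (^-homo-* x (p i) d) ⟨
    y ^ (p j ℕ.+ c) * x ^ (p i ℕ.+ d)               ∎
    where
    x = lookup xs i
    y = lookup xs j

  module NonvanishingMoment
      (y : Carrier) (B : List Carrier) (unique : Unique setoid (y ∷ B))
      {n} (a : Fin n → Carrier) (a≉0 : ∀ i → ¬ a i ≈ 0#) (n≤A : n ℕ.≤ suc (length B))
      (d : ℕ) (ι≉0 : ∀ m → 1 ℕ.≤ m → m ℕ.≤ d → ¬ ι m ≈ 0#) (K≤d : length B ℕ.≤ d)
      (degree : sumℕ (laterOccurrences a) ℕ.+ ListAction.sum (downFrom n) ℕ.+ d ≡ n ℕ.* length B)
    where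
    open DividedDifferences

    K : ℕ
    K = length B

    φ : (Carrier → Carrier) → Carrier
    φ = dividedDifference y B

    open Tensor φ (dividedDifference-linear y B)
    open Moments K φ (dividedDifference-linear y B) (dividedDifference-low y B unique) (dividedDifference-top y B unique)

    b : Fin n → Carrier
    b = inv ∘ a

    p : Fin n → ℕ
    p = laterOccurrences a

    columns : List ℕ
    columns = downFrom n

    L = tensor-linear n

    -- The factor ∏ xᵢ^pᵢ is absorbed into the rows of the Vandermonde determinant, so `u` is a
    -- signed sum of monomials.
    u : Vec Carrier n → Carrier
    u xs = det (powerRows p xs) columns

    M : ℕ → Carrier
    M j = tensor n (λ xs → dot a xs ^ j * u xs)

    M-alternatingSum : ∀ j → M j ≈ alternatingSum n (λ e → moment a j (shift p e)) columns
    M-alternatingSum j = trans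
      (T-cong L λ xs → trans (*-congˡ (sym (alternatingSum-rowProduct (powerRows p xs) columns)))
        (trans (alternatingSum-* n (dot a xs ^ j) (rowProduct (powerRows p xs)) columns)
               (alternatingSum-cong n columns (length-downFrom n) λ e _ →
                 *-congˡ (reflexive (rowProduct-shift (λ i → lookup xs i ^_) p e)))))
      (alternatingSum-linear L n (λ xs e → dot a xs ^ j * monomial xs (shift p e)) columns)

    shift-degree : ∀ j e → Vec.sum e ≡ ListAction.sum columns →
                   Vec.sum (shift p e) ℕ.+ j ≡ sumℕ p ℕ.+ ListAction.sum columns ℕ.+ j
    shift-degree j e Σe = ≡.cong (ℕ._+ j) (≡.trans (sum-shift p e) (≡.cong (sumℕ p ℕ.+_) Σe))

    M-low : ∀ j → j ℕ.< d → M j ≈ 0#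
    M-low j j<d = trans (M-alternatingSum j)
      (trans (alternatingSum-cong n columns (length-downFrom n) λ e Σe → moment-low a j (shift p e)
               (≡.subst₂ ℕ._<_ (≡.sym (shift-degree j e Σe)) degree (ℕₚ.+-monoʳ-< (sumℕ p ℕ.+ ListAction.sum columns) j<d)))
             (alternatingSum-zero n columns))

    ι≉0-K : ∀ m → 1 ℕ.≤ m → m ℕ.≤ K → ¬ ι m ≈ 0#
    ι≉0-K m 1≤m m≤K = ι≉0 m 1≤m (ℕₚ.≤-trans m≤K K≤d)

    rows : Fin n → ℕ → Carrier
    rows = confluentRows K a

    -- The functional passes through the signed sum, each moment becomes a product of row entries,
    -- and the signed sum closes up again into a determinant.
    M-top : leading b * M d ≈ factorial d * det rows columns
    M-top = begin
      leading b * M d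
        ≈⟨ *-congˡ (M-alternatingSum d) ⟩
      leading b * alternatingSum n (λ e → moment a d (shift p e)) columns
        ≈⟨ alternatingSum-* n (leading b) (λ e → moment a d (shift p e)) columns ⟩
      alternatingSum n (λ e → leading b * moment a d (shift p e)) columns
        ≈⟨ alternatingSum-cong n columns (length-downFrom n) (λ e Σe →
             trans (moment-top (inv-inverseʳ ∘ a≉0) d (shift p e) (≡.trans (shift-degree d e Σe) degree))
                   (*-congˡ (reflexive (≡.sym (rowProduct-shift (weight K ∘ b) p e))))) ⟩
      alternatingSum n (λ e → factorial d * rowProduct rows e) columns
        ≈⟨ alternatingSum-* n (factorial d) (rowProduct rows) columns ⟨
      factorial d * alternatingSum n (rowProduct rows) columns
        ≈⟨ *-congˡ (alternatingSum-rowProduct rows columns) ⟩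
      factorial d * det rows columns ∎

    M-top-≉0 : ¬ M d ≈ 0#
    M-top-≉0 Md≈0 = *-≉0 (factorial-≉0 d ι≉0) (det-confluent-≉0 K ι≉0-K a a≉0 n≤A)
      (trans (sym M-top) (trans (*-congˡ Md≈0) (zeroʳ _)))

    extend : ∀ {m} (s : Fin m → Carrier) → m ℕ.< suc d → ∃ λ z → InRestrictedSum (y ∷ B) a z × (∀ i → ¬ z ≈ s i)
    extend {m} s (s≤s m≤d) with tensor-search (dividedDifference-search y B) n
      -- The power of h pads the degree in h to exactly `d`. At the point found, the factor `u`
      -- gives distinct coordinates and the factor `avoid` a new sum.
      {f = λ xs → dot a xs ^ (d ℕ.∸ m) * (avoid s (dot a xs) * u xs)}
      (≉0-≈ (sym (avoid-top L (dot a) u d M-low s (d ℕ.∸ m) (ℕₚ.m+[n∸m]≡n m≤d))) M-top-≉0)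
    ... | xs , xs∈A , f≉0 =
      dot a xs ,
      (lookup xs , xs∈A , distinct , refl) ,
      avoid-≉0 s (λ av≈0 → f≉0 (trans (*-congˡ (trans (*-congʳ av≈0) (zeroˡ _))) (zeroʳ _)))
      where
      distinct : ∀ i j → lookup xs i ≈ lookup xs j → i ≡ j
      distinct i j xi≈xj with i Finₚ.≟ j
      ... | yes i≡j = i≡j
      ... | no  i≢j = ⊥-elim (f≉0 (trans (*-congˡ (trans
        (*-congˡ (det-proportional (powerRows p xs) i≢j (powerRows-proportional p xs xi≈xj) columns)) (zeroʳ _))) (zeroʳ _)))

    restrictedSum-many : AtLeast (suc d) (InRestrictedSum (y ∷ B) a)
    restrictedSum-many = AtLeast-greedy (suc d) extend

theorem4p2 : ∀ {c ℓ} (F : Field c ℓ) → let open FieldDefs F in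
    (p : ℕ) → IsCharacteristic p →
    (A : List Carrier) → Unique setoid A →
    (n : ℕ) → (a : Fin n → Carrier) → (∀ i → ¬ (a i ≈ 0#)) →
    n ℕ.≤ length A →
    (t : ℕ) → (cs : Fin t → Carrier) → DistinctValues a cs →
    (p ≡ 0 ⊎ n ℕ.* (length A ℕ.∸ n) ℕ.+ pairSum (λ j → mult a (cs j)) ℕ.< p) →
    AtLeast (suc (n ℕ.* (length A ℕ.∸ n) ℕ.+ pairSum (λ j → mult a (cs j)))) (InRestrictedSum A a)
theorem4p2 F p char A unique n a a≉0 n≤A t cs (cs-injective , cover , _) p>d
  with degree-dichotomy (λ j → FieldDefs.mult F a (cs j)) n (length A)
         (Multiplicities.sumℕ-multiplicities F cs cs-injective a cover) n≤A
... | inj₁ d≡0 = ≡.subst (λ k → AtLeast (suc k) (InRestrictedSum A a)) (≡.sym d≡0) (restrictedSum-nonempty A unique a n≤A)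
  where
  open FieldDefs F
  open RestrictedSumset F
-- The bound 1 ≤ |A| excludes the empty list, so there is a first node `y`; removing `suc` from both
-- sides of |A| ≤ d + 1 gives K ≤ d.
theorem4p2 F p char (y ∷ B) unique n a a≉0 n≤A t cs (cs-injective , cover , _) p>d | inj₂ (_ , s≤s K≤d) =
  restrictedSum-many
  where
  open FieldDefs F hiding (zero)
  open RestrictedSumset F
  open Multiplicities F
  d : ℕ
  d = n ℕ.* (suc (length B) ℕ.∸ n) ℕ.+ pairSum (multiplicities cs cs-injective a)
  open NonvanishingMoment y B unique a a≉0 n≤A d (ι≉0-below-characteristic char p>d) K≤d
    (degree-count n (length B) (pairSum (multiplicities cs cs-injective a)) (sumℕ (laterOccurrences a)) n≤A (pairSum-multiplicities cs cs-injective a cover))
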